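{- Let $a, b, c, n\in\mathbf{Z}$ with $n\geq 2$ and $a$ not divisible by $n$. Let $r=\gcd(a,n)$, let $k$ be the multiplicity of $2$ in $n/r$, and put $m=n/(2^k r)$, $\delta=\gcd(m,r)$, $d=b^2-4ac$. Then IQF is valid for $ax^2+bx+c\equiv 0 \bmod n$ if and only if either (a) $d$ is a quadratic non-residue of $n$, or (b) $d$ is a quadratic residue of $n$ and exactly one of the following mutually exclusive conditions holds: (i) there exists a prime factor $p$ of $2a$ such that, if $\beta$ is the multiplicity of $p$ in $2a$ and $\alpha$ is the multiplicity of $p$ in $4am$ when $k\in\{0,1,2\}$, respectively the multiplicity of $p$ in $2^k a m$ when $k\geq 3$, then $1<\beta<\alpha$, $b$ is divisible by $p$, $d$ is divisible by $p^2$, and $(p^{\alpha},p^{\beta})$ forms a $(b,d)$-obstruction; (ii) $k=0$, $b$ and $c$ are divisible by $r$, $d/r^2$ is a quadratic residue of $m$, and either $\delta=1$ or $\delta$ is the product of distinct odd primes $p_1,\dots,p_t$, each prime $p_i$ has even multiplicity $m_i$ in $m$, and $d/r^2$ is divisible by the product $p_1^{m_1}\cdots p_t^{m_t}$; (iii) $k=1$, $b$ and $c$ are divisible by $r$, $b/r$ is odd, either $a/r$ or $c/r$ is even, $d/r^2$ is a quadratic residue of $m$, and either $\delta=1$ or $\delta$ is the product of distinct odd primes $p_1,\dots,p_t$, each prime $p_i$ has even multiplicity $m_i$ in $m$, and $d/r^2$ is divisible by $p_1^{m_1}\cdots p_t^{m_t}$; (iv) $k\geq 3$, $r$ and $k$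 are odd, $b$ and $c$ are divisible by $r$, $k-1$ is the multiplicity of $2$ in $d/r^2$, $d/(r^2\cdot 2^{k-1})\equiv 1\bmod 8$, $d/r^2$ is a quadratic residue of $m$, and either $\delta=1$ or $\delta$ is the product of distinct odd primes $p_1,\dots,p_t$, each prime $p_i$ has even multiplicity $m_i$ in $m$, and $d/r^2$ is divisible by $p_1^{m_1}\cdots p_t^{m_t}$.
   Context: IQF (the intermediate form of the quadratic formula) is valid for $ax^2+bx+c\equiv 0\bmod n$, with $d=b^2-4ac$, if for every integer $x$: $ax^2+bx+c\equiv 0\bmod n$ if and only if there is an integer $s$ with $s^2\equiv d\bmod n$ and $2ax\equiv -b+s\bmod n$. An integer $u$ is a quadratic residue of a positive integer $v$ if $x^2\equiv u\bmod v$ has an integer solution (no coprimality is required; $v=1$ is allowed), and a quadratic non-residue of $v$ otherwise. The multiplicity of a prime $p$ in a nonzero integer $z$ is the largest $e\geq 0$ with $p^e\mid z$. (The integer $0$ has no finite multiplicity, so "the multiplicity of $2$ in $z$ is $k-1$" is false when $z=0$.) $(b,d)$-obstruction: let $p$ be a prime, $\alpha,\beta$ positive integers, $b,d$ integers. The pair $(p^{\alpha},p^{\beta})$ forms a $(b,d)$-obstruction if one of the following holds: (1) $d$ is not divisible by $p^{\alpha}$, the multiplicity of $p$ in $d$ is even, say $2\mu$, and, writing $d=d_1p^{2\mu}$ and letting $\Sigma$ be the set of all solutions $\sigma$, $0\leq\sigma<p^{\alpha-2\mu}$, of $x^2\equiv d_1\bmod p^{\alpha-2\mu}$, one has $\sigma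 p^{\mu}+ip^{\alpha-\mu}\not\equiv b\bmod p^{\beta}$ for all $\sigma\in\Sigma$ and all $i\in\{0,1,\dots,p^{\mu}-1\}$; (2) $d$ is divisible by $p^{\alpha}$ and, with $s$ chosen so that $\alpha=2s$ if $\alpha$ is even and $\alpha=2s-1$ if $\alpha$ is odd, one has $ip^{s}\not\equiv b\bmod p^{\beta}$ for all $i\in\{0,1,\dots,p^{\alpha-s}-1\}$. -}

module Defs where

open import Data.Fin.Base using (Fin; zero; suc)
open import Data.Integer.Base using (ℤ; +_; -_; _+_; _-_; _*_)
open import Data.Integer.Divisibility.Signed using (_∣_)
open import Data.List.Base using (List; map)
open import Data.List.Relation.Unary.All using (All)
open import Data.List.Relation.Unary.Unique.Propositional using (Unique)
import Data.Nat.Base as ℕ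
open ℕ using (ℕ; _∸_; _^_; _≤_; _<_)
import Data.Nat.Divisibility as ℕ∣
open import Data.Nat.ListAction using (product)
open import Data.Nat.Primality using (Prime)
open import Data.Product using (_×_; _,_; proj₁; ∃-syntax)
open import Data.Sum.Base using (_⊎_)
open import Function.Bundles using (_⇔_)
open import Relation.Binary.PropositionalEquality using (_≡_)
open import Relation.Nullary.Negation using (¬_)

infix 4 _≈_[mod_]

_≈_[mod_] : ℤ → ℤ → ℕ → Set
x ≈ y [mod n ] = + n ∣ x - y

discriminant : ℤ → ℤ → ℤ → ℤ
discriminant a b c = b * b - + 4 * a * c

IQFValid : ℤ → ℤ → ℤ → ℕ → Set
IQFValid a b c n = ∀ (x : ℤ) →
  (a * x * x + b * x + c ≈ + 0 [mod n ])
  ⇔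
  (∃[ s ] (s * s ≈ discriminant a b c [mod n ])
        × (+ 2 * a * x ≈ - b + s [mod n ]))

QuadraticResidue : ℤ → ℕ → Set
QuadraticResidue u v = ∃[ x ] (x * x ≈ u [mod v ])

-- For prime p this forces z ≢ 0: every power of p divides 0.
IsMultiplicity : (p e : ℕ) → ℤ → Set
IsMultiplicity p e z =
  (+ (p ^ e) ∣ z) × (∀ f → + (p ^ f) ∣ z → f ≤ e)

Evenℕ Oddℕ : ℕ → Set
Evenℕ n = 2 ℕ∣.∣ n
Oddℕ n = ¬ (2 ℕ∣.∣ n)

Evenℤ Oddℤ : ℤ → Set
Evenℤ z = + 2 ∣ z
Oddℤ z = ¬ (+ 2 ∣ z)

-- (p ^ α , p ^ β) forms a (b , d)-obstruction; meant for p prime and α, β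
-- positive.  In the first alternative 2μ < α, because p ^ α does not divide d,
-- so the truncated subtractions there are genuine; in the second, s ≤ α.
Obstruction : (p α β : ℕ) (b d : ℤ) → Set
Obstruction p α β b d =
    ( ¬ (+ (p ^ α) ∣ d)
    × ∃[ μ ] ∃[ d₁ ]
        IsMultiplicity p (2 ℕ.* μ) d
      × d ≡ d₁ * + (p ^ (2 ℕ.* μ))
      × (∀ (σ i : ℕ) →
           σ < p ^ (α ∸ 2 ℕ.* μ) →
           + σ * + σ ≈ d₁ [mod p ^ (α ∸ 2 ℕ.* μ) ] →
           i < p ^ μ →
           ¬ (+ (σ ℕ.* p ^ μ ℕ.+ i ℕ.* p ^ (α ∸ μ)) ≈ b [mod p ^ β ])))
  ⊎ ( (+ (p ^ α) ∣ d)
    × ∃[ s ]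
        (α ≡ 2 ℕ.* s ⊎ ℕ.suc α ≡ 2 ℕ.* s)
      × (∀ (i : ℕ) → i < p ^ (α ∸ s) →
           ¬ (+ (i ℕ.* p ^ s) ≈ b [mod p ^ β ])))

-- The list pms consists of the pairs (pᵢ , mᵢ); e plays the role of d / r².
δ-Condition : (m δ : ℕ) (e : ℤ) → Set
δ-Condition m δ e =
    δ ≡ 1
  ⊎ ∃[ pms ]
      Unique (map proj₁ pms)
    × All (λ { (p , mᵢ) → Prime p × Oddℕ p
                        × IsMultiplicity p mᵢ (+ m) × Evenℕ mᵢ }) pms
    × δ ≡ product (map proj₁ pms)
    × + product (map (λ { (p , mᵢ) → p ^ mᵢ }) pms) ∣ e

-- In the conditions below an exact quotient u / v, with v ≢ 0, is given as the
-- (unique) q such that u ≡ q * v.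

Condition-i : (a b d : ℤ) (k m : ℕ) → Set
Condition-i a b d k m =
  ∃[ p ] ∃[ α ] ∃[ β ]
    Prime p
  × (+ p ∣ + 2 * a)
  × IsMultiplicity p β (+ 2 * a)
  × ( (k ≤ 2 × IsMultiplicity p α (+ 4 * a * + m))
    ⊎ (3 ≤ k × IsMultiplicity p α (+ (2 ^ k) * a * + m)))
  × 1 < β
  × β < α
  × (+ p ∣ b)
  × (+ (p ^ 2) ∣ d)
  × Obstruction p α β b d

Condition-ii : (b c d : ℤ) (r k m δ : ℕ) → Set
Condition-ii b c d r k m δ =
    k ≡ 0
  × (+ r ∣ b)
  × (+ r ∣ c)
  × ∃[ e ]
      d ≡ e * + (r ^ 2)
    × QuadraticResidue e m
    × δ-Condition m δ e

Condition-iii : (a b c d : ℤ) (r k m δ : ℕ) → Set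
Condition-iii a b c d r k m δ =
    k ≡ 1
  × ∃[ a′ ] ∃[ b′ ] ∃[ c′ ] ∃[ e ]
      a ≡ a′ * + r
    × b ≡ b′ * + r
    × c ≡ c′ * + r
    × d ≡ e * + (r ^ 2)
    × Oddℤ b′
    × (Evenℤ a′ ⊎ Evenℤ c′)
    × QuadraticResidue e m
    × δ-Condition m δ e

Condition-iv : (b c d : ℤ) (r k m δ : ℕ) → Set
Condition-iv b c d r k m δ =
    3 ≤ k
  × Oddℕ r
  × Oddℕ k
  × (+ r ∣ b)
  × (+ r ∣ c)
  × ∃[ e ] ∃[ f ]
      d ≡ e * + (r ^ 2)
    × IsMultiplicity 2 (k ∸ 1) e
    × d ≡ f * + (r ^ 2 ℕ.* 2 ^ (k ∸ 1))
    × f ≈ + 1 [mod 8 ]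
    × QuadraticResidue e m
    × δ-Condition m δ e

Condition : (a b c : ℤ) (r k m δ : ℕ) → Fin 4 → Set
Condition a b c r k m δ = λ where
    zero                   → Condition-i a b d k m
    (suc zero)             → Condition-ii b c d r k m δ
    (suc (suc zero))       → Condition-iii a b c d r k m δ
    (suc (suc (suc zero))) → Condition-iv b c d r k m δ
  where d = discriminant a b c

{-# OPTIONS --safe #-}

-- Since (2ax + b)² - d = 4a f(x) with f(x) = ax² + bx + c, IQF is valid iff n ∣ f(x) for every
-- x with n ∣ 4a f(x), that is, with 2ᵏm ∣ 4 f(x).  Call such an x a root.
--
-- By the Chinese remainder theorem a root is missing iff it is missing at one prime power pᵉ
-- exactly dividing m or 2ᵏ⁻¹m.  Solving 2ax + b = s p-adically, that means that d has no square
-- root s modulo p^(β+e) congruent to b modulo p^β; if d is a quadratic residue of n at all, this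
-- is a (b , d)-obstruction, i.e. condition (i).
--
-- If there is a root x₀ and IQF is valid, comparing f(x₀) with its values at the neighbouring
-- roots gives r ∣ b and r ∣ c, settles k ≤ 2 by parity, and otherwise leaves for each prime p a
-- quadratic t(αt + β) with p ∤ α for which divisibility by a power of p forces divisibility by a
-- higher one.  Trial values of t that are powers of p, with exponents around half of the power in
-- question, pin down the valuations of β and r.  Conversely, the conditions (ii)-(iv) let one read
-- off the higher divisibility from (2a′x + b′)² = 4a′f(x)/r + d/r².
module Submission where

open import Defs
open import Data.Fin.Base using (Fin; zero; suc)
open import Data.Integer.Base using (ℤ; +_; -_; _+_; _-_; ∣_∣) renaming (_*_ to _·_)
import Data.Integer.Base as ℤ
import Data.Integer.DivMod as ℤ/
open import Data.Integer.Divisibility.Signed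
import Data.Integer.Properties as ℤₚ
open import Data.Integer.Tactic.RingSolver using (solve-∀)
open import Data.List.Base using (List; []; _∷_; map)
open import Data.List.Membership.Propositional using (_∈_)
open import Data.List.Relation.Unary.All using (All; []; _∷_)
import Data.List.Relation.Unary.All as All
open import Data.List.Relation.Unary.All.Properties using (map⁺)
open import Data.List.Relation.Unary.AllPairs using ([]; _∷_)
open import Data.List.Relation.Unary.Any using (here; there)
open import Data.List.Relation.Unary.Unique.Propositional using (Unique)
import Data.Nat.Base as ℕ
open ℕ using (ℕ; zero; suc; _*_; _^_; _∸_; _≤_; _<_; s≤s; z≤n; NonZero)
import Data.Nat.Coprimality as Coprimality
import Data.Nat.Divisibility as ℕ∣
open import Data.Nat.GCD using (gcd; gcd[m,n]∣m; gcd[m,n]∣n; gcd-greatest; gcd[m,n]≡0⇒m≡0; module Bézout)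
open import Data.Nat.Induction using (<-rec)
open import Data.Nat.ListAction using (product)
open import Data.Nat.ListAction.Properties using (∈⇒∣product)
open import Data.Nat.Primality using (Prime; ¬prime[1]; prime[2]; prime⇒nonZero; prime⇒nonTrivial; prime⇒irreducible; euclidsLemma)
open import Data.Nat.Primality.Factorisation using (factorise; PrimeFactorisation; factorisationHasAllPrimeFactors)
import Data.Nat.Properties as ℕₚ
open import Data.Product using (_×_; _,_; proj₁; proj₂; ∃₂; ∃-syntax; ∃!)
open import Data.Sum.Base using (_⊎_; inj₁; inj₂; [_,_]′)
open import Function.Base using (_∘_)
open import Function.Bundles using (_⇔_; mk⇔; Equivalence)
open import Relation.Binary.PropositionalEquality using (_≡_; _≢_; refl; sym; trans; cong; cong₂; subst; subst₂)
open import Relation.Nullary using (¬_; yes; no; Dec; contradiction; map′)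

-- Coprimality and valuations in ℤ

-- The exponents in (i) come from solving for 2f rather than f. The number 2ax + b runs through a
-- class modulo 2a, so β is a multiplicity in 2a; and since 4af = 2a · 2f, asking p^e of 2f is
-- asking p^(β+e) of (2ax + b)² - d. For k ≤ 2 the power 2^k divides 4, a root needs only m ∣ 2f,
-- and α is a multiplicity in 4am. For k ≥ 3 it needs 2^(k-1) m ∣ 2f, and α is a multiplicity in 2a
-- · 2^(k-1) m = 2^k a m. The parity clauses of (ii)-(iv) come from squares. At an odd prime p ∣ δ a
-- root loses to r some factors p that validity must recover. If M is even, p^(M-1) ∣ z² already
-- gives p^M ∣ z², so one lost factor can be regained; a second cannot, which makes δ squarefree. At
-- 2 two factors are lost to the 4, and they are regained because odd squares are 1 modulo 8; this
-- is the source of the odd k and of the class modulo 8. No excluded middle is available, so every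
-- case distinction rests on a finite search: for roots modulo a number, for square roots of d, for
-- multiplicities.

infix 4 _⟂_

-- Coprimality as Bézout coefficients: cancellation, inverses and the Chinese remainder theorem then
-- reduce to ring identities with explicit witnesses.
_⟂_ : ℤ → ℤ → Set
u ⟂ v = ∃₂ λ x y → x · u + y · v ≡ + 1

scale : ∀ {w} z → w ≡ + 1 → z ≡ z · w
scale z refl = sym (ℤₚ.*-identityʳ z)

⟂-sym : ∀ {u v} → u ⟂ v → v ⟂ u
⟂-sym (x , y , eq) = y , x , trans (ℤₚ.+-comm (y · _) _) eq

⟂-·ʳ : ∀ {u v w} → u ⟂ v → u ⟂ w → u ⟂ v · w
⟂-·ʳ {u} {v} {w} (x , y , eq) (x′ , y′ , eq′) =
  x · x′ · u + x · y′ · w + y · v · x′ , y · y′ ,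
  trans (expand u v w x y x′ y′) (cong₂ _·_ eq eq′)
  where
  expand : ∀ u v w x y x′ y′ →
    (x · x′ · u + x · y′ · w + y · v · x′) · u + y · y′ · (v · w)
    ≡ (x · u + y · v) · (x′ · u + y′ · w)
  expand = solve-∀

⟂-∣ʳ : ∀ {u v w} → u ⟂ v → w ∣ v → u ⟂ w
⟂-∣ʳ {u} {w = w} (x , y , eq) (divides q refl) = x , y · q , trans (assoc u w x y q) eq
  where
  assoc : ∀ u w x y q → x · u + y · q · w ≡ x · u + y · (q · w)
  assoc = solve-∀

⟂-1 : ∀ u → u ⟂ + 1
⟂-1 u = + 0 , + 1 , identity u
  where
  identity : ∀ u → + 0 · u + + 1 · + 1 ≡ + 1
  identity = solve-∀

⟂-cancel : ∀ {u v z} → u ⟂ v → u ∣ v · z → u ∣ z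
⟂-cancel {u} {v} {z} (x , y , eq) h =
  subst (u ∣_) (sym (trans (scale z eq) (expand u v z x y)))
    (∣m∣n⇒∣m+n (∣n⇒∣m*n (z · x) ∣-refl) (∣n⇒∣m*n y h))
  where
  expand : ∀ u v z x y → z · (x · u + y · v) ≡ z · x · u + y · (v · z)
  expand = solve-∀

⟂-∣-· : ∀ {u v z} → u ⟂ v → u ∣ z → v ∣ z → u · v ∣ z
⟂-∣-· {u} {v} {z} (x , y , eq) (divides q p) (divides q′ p′) =
  divides (q′ · x + q · y) (trans (scale z eq)
    (trans (distrib z (x · u) (y · v))
      (trans (cong₂ (λ s t → s · (x · u) + t · (y · v)) p′ p) (expand u v x y q q′))))
  where
  distrib : ∀ z s t → z · (s + t) ≡ z · s + z · t
  distrib = solve-∀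
  expand : ∀ u v x y q q′ →
    q′ · v · (x · u) + q · u · (y · v) ≡ (q′ · x + q · y) · (u · v)
  expand = solve-∀

⟂-solve : ∀ {u v} → u ⟂ v → ∀ z → ∃[ x ] v ∣ u · x - z
⟂-solve {u} {v} (x , y , eq) z = x · z , divides (- (y · z))
  (trans (cong (λ t → u · (x · z) - t) (scale z eq)) (expand u v x y z))
  where
  expand : ∀ u v x y z → u · (x · z) - z · (x · u + y · v) ≡ - (y · z) · v
  expand = solve-∀

⟂-crt : ∀ {u v} → u ⟂ v → ∀ y z → ∃[ x ] (u ∣ x - y) × (v ∣ x - z)
⟂-crt {u} {v} (s , t , eq) y z = y · (t · v) + z · (s · u)
  , divides ((z - y) · s) (trans (cong (λ w → y · (t · v) + z · (s · u) - w) (scale y eq)) (left u v s t y z))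
  , divides ((y - z) · t) (trans (cong (λ w → y · (t · v) + z · (s · u) - w) (scale z eq)) (right u v s t y z))
  where
  left : ∀ u v s t y z →
    y · (t · v) + z · (s · u) - y · (s · u + t · v) ≡ (z - y) · s · u
  left = solve-∀
  right : ∀ u v s t y z →
    y · (t · v) + z · (s · u) - z · (s · u + t · v) ≡ (y - z) · t · v
  right = solve-∀

coprime⇒⟂ : ∀ u v → Coprimality.Coprime ∣ u ∣ ∣ v ∣ → u ⟂ v
coprime⇒⟂ u v co with m∣∣m∣ {u} | m∣∣m∣ {v} | Coprimality.coprime-Bézout co
... | divides q eq | divides q′ eq′ | Bézout.+- x y id =
  + x · q , - (+ y · q′) ,
  trans (cong₂ _+_ (ℤₚ.*-assoc (+ x) q u) (neg (+ y) q′ v))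
    (trans (cong₂ (λ s t → + x · s - + y · t) (sym eq) (sym eq′))
      (trans (cong₂ _-_ (sym (ℤₚ.pos-* x ∣ u ∣)) (sym (ℤₚ.pos-* y ∣ v ∣)))
        (trans (cong (λ t → + t - + (y * ∣ v ∣)) (sym id))
          (trans (cong (_- + (y * ∣ v ∣)) (ℤₚ.pos-+ 1 (y * ∣ v ∣))) (cancel (+ (y * ∣ v ∣)))))))
  where
  neg : ∀ a b c → - (a · b) · c ≡ - (a · (b · c))
  neg = solve-∀
  cancel : ∀ t → + 1 + t - t ≡ + 1
  cancel = solve-∀
... | divides q eq | divides q′ eq′ | Bézout.-+ x y id =
  - (+ x · q) , + y · q′ ,
  trans (cong₂ _+_ (neg (+ x) q u) (ℤₚ.*-assoc (+ y) q′ v))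
    (trans (cong₂ (λ s t → - (+ x · s) + + y · t) (sym eq) (sym eq′))
      (trans (cong₂ (λ s t → - s + t) (sym (ℤₚ.pos-* x ∣ u ∣)) (sym (ℤₚ.pos-* y ∣ v ∣)))
        (trans (cong (λ t → - + (x * ∣ u ∣) + + t) (sym id))
          (trans (cong (λ t → - + (x * ∣ u ∣) + t) (ℤₚ.pos-+ 1 (x * ∣ u ∣))) (cancel (+ (x * ∣ u ∣)))))))
  where
  neg : ∀ a b c → - (a · b) · c ≡ - (a · (b · c))
  neg = solve-∀
  cancel : ∀ t → - t + (+ 1 + t) ≡ + 1
  cancel = solve-∀

prime-⟂ : ∀ {p u} → Prime p → ¬ (+ p ∣ u) → + p ⟂ u
prime-⟂ {p} {u} pp p∤u = coprime⇒⟂ (+ p) u λ {d} (d∣p , d∣u) →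
  [ (λ d≡1 → d≡1) , (λ { refl → contradiction (∣ᵤ⇒∣ d∣u) p∤u }) ]′ (prime⇒irreducible pp d∣p)

prime∤1 : ∀ {p} → Prime p → ¬ (+ p ∣ + 1)
prime∤1 pp h = ℕ.nonTrivial⇒≢1 {{prime⇒nonTrivial pp}} (ℕ∣.∣1⇒≡1 (∣⇒∣ᵤ h))

⟂⇒∤ : ∀ {p u} → Prime p → + p ⟂ u → ¬ (+ p ∣ u)
⟂⇒∤ {p} {u} pp p⟂u p∣u = prime∤1 pp (⟂-cancel p⟂u (∣m⇒∣m*n (+ 1) p∣u))

euclid : ∀ {p} → Prime p → ∀ x y → + p ∣ x · y → (+ p ∣ x) ⊎ (+ p ∣ y)
euclid {p} pp x y h with + p ∣? x
... | yes p∣x = inj₁ p∣x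
... | no p∤x = inj₂ (⟂-cancel (prime-⟂ pp p∤x) h)

-- Powers of a prime and multiplicities

pow : ℕ → ℕ → ℤ
pow p e = + (p ^ e)

pow-suc : ∀ p e → pow p (suc e) ≡ + p · pow p e
pow-suc p e = ℤₚ.pos-* p (p ^ e)

pow-+ : ∀ p i j → pow p (i ℕ.+ j) ≡ pow p i · pow p j
pow-+ p i j = trans (cong +_ (ℕₚ.^-distribˡ-+-* p i j)) (ℤₚ.pos-* (p ^ i) (p ^ j))

pow-double : ∀ p i → pow p (2 * i) ≡ pow p i · pow p i
pow-double p i = trans (cong (λ t → pow p (i ℕ.+ t)) (ℕₚ.+-identityʳ i)) (pow-+ p i i)

pow-1 : ∀ p → pow p 1 ≡ + p
pow-1 p = cong +_ (ℕₚ.*-identityʳ p)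

pow-mono : ∀ p {i j} → i ≤ j → pow p i ∣ pow p j
pow-mono p {i} {j} i≤j = subst (λ t → pow p i ∣ pow p t) (ℕₚ.m∸n+n≡m i≤j)
  (divides (pow p (j ∸ i)) (pow-+ p (j ∸ i) i))

∣pow : ∀ p {e} → 0 < e → + p ∣ pow p e
∣pow p {e} 0<e = subst (_∣ pow p e) (pow-1 p) (pow-mono p 0<e)

pow-nonZero : ∀ {p} → Prime p → ∀ e → ℤ.NonZero (pow p e)
pow-nonZero {p} pp e = ℕₚ.m^n≢0 p e {{prime⇒nonZero pp}}

pow-cancel : ∀ {p} → Prime p → ∀ i {j y} → pow p (i ℕ.+ j) ∣ pow p i · y → pow p j ∣ y
pow-cancel {p} pp i {j} {y} h = *-cancelˡ-∣ (pow p i) {{pow-nonZero pp i}}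
  (subst (_∣ pow p i · y) (pow-+ p i j) h)

pow-⟂ : ∀ {p u} → Prime p → ¬ (+ p ∣ u) → ∀ e → pow p e ⟂ u
pow-⟂ pp p∤u zero = ⟂-sym (⟂-1 _)
pow-⟂ {p} {u} pp p∤u (suc e) = subst (_⟂ u) (sym (pow-suc p e))
  (⟂-sym (⟂-·ʳ (⟂-sym (prime-⟂ pp p∤u)) (⟂-sym (pow-⟂ pp p∤u e))))

pow-∣⇒≤ : ∀ {p u} → Prime p → ¬ (+ p ∣ u) → ∀ {i j} → pow p i ∣ u · pow p j → i ≤ j
pow-∣⇒≤ {p} {u} pp p∤u {i} {j} h = ℕₚ.≮⇒≥ λ j<i →
  p∤u (subst (_∣ u) (pow-1 p) (pow-cancel pp j {1} {u}
    (subst (pow p (j ℕ.+ 1) ∣_) (ℤₚ.*-comm u _)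
      (∣-trans (pow-mono p (subst (_≤ i) (ℕₚ.+-comm 1 j) j<i)) h))))

¬pow-∣ : ∀ {p u} → Prime p → ¬ (+ p ∣ u) → ∀ {i j} → j < i → ¬ (pow p i ∣ u · pow p j)
¬pow-∣ pp p∤u j<i h = ℕₚ.<⇒≱ j<i (pow-∣⇒≤ pp p∤u h)

cofactor⇒multiplicity : ∀ {p u} → Prime p → ¬ (+ p ∣ u) → ∀ {e z} → z ≡ u · pow p e →
  IsMultiplicity p e z
cofactor⇒multiplicity {u = u} pp p∤u refl = divides u refl , λ f → pow-∣⇒≤ pp p∤u

multiplicity⇒cofactor : ∀ {p e z} → IsMultiplicity p e z → ∃[ u ] z ≡ u · pow p e × ¬ (+ p ∣ u)
multiplicity⇒cofactor {p} {e} {z} (divides u refl , max) = u , refl , λ p∣u →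
  ℕₚ.n≮n e (max (suc e) (subst (_∣ u · pow p e) (sym (pow-suc p e)) (*-monoˡ-∣ (pow p e) p∣u)))

-- A search up to a threshold, which makes sense for z = 0 as well. Most arguments below only
-- compare a valuation with half of a given exponent, so this form serves them without a case for
-- zero.
multiplicity-below : ∀ p z f → (∃[ e ] e < f × IsMultiplicity p e z) ⊎ (pow p f ∣ z)
multiplicity-below p z zero = inj₂ (divides z (sym (ℤₚ.*-identityʳ z)))
multiplicity-below p z (suc f) with multiplicity-below p z f
... | inj₁ (e , e<f , mult) = inj₁ (e , ℕₚ.m<n⇒m<1+n e<f , mult)
... | inj₂ h with pow p (suc f) ∣? z
...   | yes h′ = inj₂ h′
...   | no ¬h′ = inj₁ (f , ℕₚ.n<1+n f , h , λ g g∣z → ℕₚ.≮⇒≥ λ f<g → ¬h′ (∣-trans (pow-mono p f<g) g∣z))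

n<2^n : ∀ n → n < 2 ^ n
n<2^n zero = s≤s z≤n
n<2^n (suc n) = ℕₚ.+-mono-≤ (ℕₚ.m^n>0 2 n) (subst (suc n ≤_) (sym (ℕₚ.+-identityʳ (2 ^ n))) (n<2^n n))

n<p^n : ∀ {p} → Prime p → ∀ n → n < p ^ n
n<p^n {p} pp n = ℕₚ.<-≤-trans (n<2^n n) (ℕₚ.^-monoˡ-≤ n (ℕ.nonTrivial⇒n>1 p {{prime⇒nonTrivial pp}}))

multiplicity : ∀ {p z} → Prime p → z ≢ + 0 → ∃[ e ] IsMultiplicity p e z
-- The bound ∣z∣ suffices: p^∣z∣ exceeds ∣z∣, so it cannot divide a nonzero z.
multiplicity {p} {z} pp z≢0 with multiplicity-below p z ∣ z ∣
... | inj₁ (e , _ , mult) = e , mult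
... | inj₂ h = contradiction (ℕ∣.∣⇒≤ {{ℕ.≢-nonZero (z≢0 ∘ ℤₚ.∣i∣≡0⇒i≡0)}} (∣⇒∣ᵤ h)) (ℕₚ.<⇒≱ (n<p^n pp ∣ z ∣))

-- Roots of quadratics modulo M

quad : ℤ → ℤ → ℤ → ℤ → ℤ
quad a b c x = a · x · x + b · x + c

quad-cong : ∀ a b c {M x y} → M ∣ x - y → M ∣ quad a b c y → M ∣ quad a b c x
quad-cong a b c {M} {x} {y} x≈y h = subst (M ∣_) (identity a b c x y)
  (∣m∣n⇒∣m+n (∣m⇒∣m*n (a · (x + y) + b) x≈y) h)
  where
  identity : ∀ a b c x y →
    (x - y) · (a · (x + y) + b) + (a · y · y + b · y + c) ≡ a · x · x + b · x + c
  identity = solve-∀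

∣-remainder : ∀ x M .{{_ : NonZero M}} → + M ∣ + (x ℤ/.%ℕ M) - x
∣-remainder x M = divides (- (x ℤ/./ℕ M)) (trans (cong (λ t → + (x ℤ/.%ℕ M) - t) (ℤ/.a≡a%ℕn+[a/ℕn]*n x M))
  (cancel (+ (x ℤ/.%ℕ M)) (x ℤ/./ℕ M) (+ M)))
  where
  cancel : ∀ s q m → s - (s + q · m) ≡ - q · m
  cancel = solve-∀

-- Roots depend only on x modulo M, so the residues below M are searched. This also decides whether
-- d is a quadratic residue.
quad-root? : ∀ a b c M .{{_ : NonZero M}} → Dec (∃[ x ] + M ∣ quad a b c x)
quad-root? a b c M = map′
  (λ (x , _ , h) → + x , h)
  (λ (x , h) → x ℤ/.%ℕ M , ℤ/.n%ℕd<d x M , quad-cong a b c (∣-remainder x M) h)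
  (ℕₚ.anyUpTo? (λ x → + M ∣? quad a b c (+ x)) M)

∃-prime-factor : ∀ M → 1 < M → ∃[ p ] Prime p × p ℕ∣.∣ M
∃-prime-factor M@(suc _) 1<M with factorise M
... | record { factors = [] ; isFactorisation = refl } = contradiction 1<M (ℕₚ.n≮n 1)
... | record { factors = p ∷ ps ; isFactorisation = eq ; factorsPrime = pp ∷ _ } =
  p , pp , subst (p ℕ∣.∣_) (sym eq) (ℕ∣.m∣m*n (product ps))

factor-power : ∀ {p} → Prime p → ∀ M .{{_ : NonZero M}} → p ℕ∣.∣ M →
  ∃₂ λ e M′ → 1 ≤ e × M ≡ M′ * p ^ e × ¬ (+ p ∣ + M′)
factor-power {p} pp M p∣M with multiplicity pp (ℕ.≢-nonZero⁻¹ M ∘ ℤₚ.+-injective)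
... | e , mult@(d , max) with multiplicity⇒cofactor mult | ∣⇒∣ᵤ d
...   | u , eq , p∤u | ℕ∣.divides M′ eq′ =
  e , M′ , max 1 (subst (_∣ + M) (sym (pow-1 p)) (∣ᵤ⇒∣ p∣M)) , eq′ , λ p∣M′ → p∤u (subst (+ p ∣_) (same M′ u eq′ eq) p∣M′)
  where
  same : ∀ M′ u → M ≡ M′ * p ^ e → + M ≡ u · pow p e → + M′ ≡ u
  same M′ u eq′ eq = ℤₚ.*-cancelʳ-≡ (+ M′) u (pow p e) {{pow-nonZero pp e}}
    (trans (sym (ℤₚ.pos-* M′ (p ^ e))) (trans (cong +_ (sym eq′)) eq))

-- The cofactor M′ prime to p records that e is the full multiplicity of p in M; condition (i) needs
-- its α to be exact.
LocalObstacle : ℤ → ℤ → ℤ → ℕ → Set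
LocalObstacle a b c M = ∃[ p ] ∃[ e ] ∃[ M′ ]
  Prime p × 1 ≤ e × M ≡ M′ * p ^ e × ¬ (+ p ∣ + M′) × ¬ (∃[ x ] pow p e ∣ quad a b c x)

Dichotomy : ℤ → ℤ → ℤ → ℕ → Set
Dichotomy a b c M = (∃[ x ] + M ∣ quad a b c x) ⊎ LocalObstacle a b c M

quad-root-·-pow : ∀ {a b c p} e M → Prime p → ¬ (+ p ∣ + M) →
  (∃[ x ] pow p e ∣ quad a b c x) → (∃[ x ] + M ∣ quad a b c x) →
  ∃[ x ] + (M * p ^ e) ∣ quad a b c x
quad-root-·-pow {a} {b} {c} {p} e M pp p∤M (x , hx) (y , hy) =
  let M⟂pow = ⟂-sym (pow-⟂ pp p∤M e)
      z , z≈y , z≈x = ⟂-crt M⟂pow y x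
  in z , subst (_∣ quad a b c z) (sym (ℤₚ.pos-* M (p ^ e)))
       (⟂-∣-· M⟂pow (quad-cong a b c z≈y hy) (quad-cong a b c z≈x hx))

-- The prime q of the obstacle divides M, which is coprime to p^e, so q does not divide p^e and its
-- exponent stays exact in the product.
obstacle-·-pow : ∀ {a b c p} e M → Prime p → ¬ (+ p ∣ + M) →
  LocalObstacle a b c M → LocalObstacle a b c (M * p ^ e)
obstacle-·-pow {p = p} e M pp p∤M (q , f , N , qq , 1≤f , eq , q∤N , ¬root) =
  q , f , N * p ^ e , qq , 1≤f , M-eq , q∤ , ¬root
  where
  M-eq : M * p ^ e ≡ N * p ^ e * q ^ f
  M-eq = trans (cong (_* p ^ e) eq)
    (trans (ℕₚ.*-assoc N _ _) (trans (cong (N *_) (ℕₚ.*-comm (q ^ f) (p ^ e))) (sym (ℕₚ.*-assoc N _ _))))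
  q∣M : + q ∣ + M
  q∣M = subst (+ q ∣_) (trans (sym (ℤₚ.pos-* N (q ^ f))) (cong +_ (sym eq))) (∣n⇒∣m*n (+ N) (∣pow q 1≤f))
  q∤ : ¬ (+ q ∣ + (N * p ^ e))
  q∤ h = ⟂⇒∤ qq (⟂-·ʳ (prime-⟂ qq q∤N) (⟂-sym (⟂-∣ʳ (pow-⟂ pp p∤M e) q∣M)))
    (subst (+ q ∣_) (ℤₚ.pos-* N (p ^ e)) h)

-- Strong induction strips one full prime power from M at a time. Either it has no root and is
-- itself the obstacle, or its root is glued to one for the cofactor, or the obstacle of the
-- cofactor is passed on.
local-global : ∀ a b c M → 1 ≤ M → Dichotomy a b c M
local-global a b c = <-rec (λ M → 1 ≤ M → Dichotomy a b c M) step
  where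
  step : ∀ M → (∀ {N} → N < M → 1 ≤ N → Dichotomy a b c N) → 1 ≤ M → Dichotomy a b c M
  step M rec 1≤M with 1 ℕₚ.<? M
  ... | no 1≮M = inj₁ (+ 0 , subst (λ N → + N ∣ quad a b c (+ 0)) (ℕₚ.≤-antisym 1≤M (ℕₚ.≮⇒≥ 1≮M))
          (divides (quad a b c (+ 0)) (sym (ℤₚ.*-identityʳ _))))
  ... | yes 1<M with ∃-prime-factor M 1<M
  ...   | p , pp , p∣M with factor-power pp M {{ℕ.>-nonZero 1≤M}} p∣M
  ...     | e , M′ , 1≤e , eq , p∤M′ with quad-root? a b c (p ^ e) {{pow-nonZero pp e}}
  ...       | no ¬root = inj₂ (p , e , M′ , pp , 1≤e , eq , p∤M′ , ¬root)
  ...       | yes root with rec M′<M 1≤M′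
    where
    1≤M′ : 1 ≤ M′
    1≤M′ = ℕₚ.n≢0⇒n>0 λ { refl → p∤M′ (divides (+ 0) refl) }
    M′<M : M′ < M
    M′<M = subst (M′ <_) (sym eq) (ℕₚ.m<m*n M′ (p ^ e) {{ℕ.>-nonZero 1≤M′}}
      (ℕₚ.≤-<-trans 1≤e (n<p^n pp e)))
  ...         | inj₁ root′ = inj₁ (subst (λ N → ∃[ x ] + N ∣ quad a b c x) (sym eq)
                  (quad-root-·-pow {a} {b} {c} e M′ pp p∤M′ root root′))
  ...         | inj₂ obstacle = inj₂ (subst (LocalObstacle a b c) (sym eq)
                  (obstacle-·-pow {a} {b} {c} e M′ pp p∤M′ obstacle))

-- Lifting divisibility along t (α t + β)

-- The witness is n/2 rounded up, the least h such that p^n ∣ (p^h)²; it has the format of the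
-- exponent s in `Obstruction`.
parity : ∀ n → ∃[ h ] (n ≡ 2 * h ⊎ suc n ≡ 2 * h)
parity zero = 0 , inj₁ refl
parity (suc n) with parity n
... | h , inj₁ refl = suc h , inj₂ (sym (ℕₚ.*-suc 2 h))
... | h , inj₂ eq = h , inj₁ eq

2*≤ : ∀ {w h K} → w < h → (K ≡ 2 * h ⊎ suc K ≡ 2 * h) → 2 * w < K
2*≤ {w} {h} {K} w<h eq = ℕₚ.≤-pred (ℕₚ.≤-trans (subst (_≤ 2 * h) (ℕₚ.*-suc 2 w) (ℕₚ.*-monoʳ-≤ 2 w<h)) (bound eq))
  where
  bound : (K ≡ 2 * h ⊎ suc K ≡ 2 * h) → 2 * h ≤ suc K
  bound (inj₁ refl) = ℕₚ.n≤1+n _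
  bound (inj₂ eq) = ℕₚ.≤-reflexive (sym eq)

-- The increment f(x₀ + t) - f(x₀) of a quadratic with leading coefficient α and derivative β at x₀.
trans-quad : ℤ → ℤ → ℤ → ℤ
trans-quad α β t = t · (α · t + β)

module _ {p : ℕ} (pp : Prime p) (p∤2 : ¬ (+ p ∣ + 2)) where

  -- Write Q for the quadratic. As p ∣ r, divisibility of Q by p^N already forces p^(N+1). With h
  -- half of N + 1 rounded up, a valuation of β below h is refuted by a pair of opposite trial
  -- values, so p^h ∣ β. At t = p^(h-1) the term αt² then dominates and Q has valuation exactly
  -- 2(h-1). This contradicts the lift when N + 1 is odd, and also when p² ∣ r.
  odd-prime-lift : ∀ {α β r N} → ¬ (+ p ∣ α) → + p ∣ r →
    (∀ t → pow p (suc N) ∣ r · trans-quad α β t → pow p (suc N) ∣ trans-quad α β t) →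
    Evenℕ (suc N) × ¬ (+ p · + p ∣ r) × pow p (suc N) ∣ β · β
  odd-prime-lift {α} {β} {r} {N} p∤α p∣r H = result
    where
    H₁ : ∀ t → pow p N ∣ trans-quad α β t → pow p (suc N) ∣ trans-quad α β t
    H₁ t h = H t (subst (_∣ r · trans-quad α β t) (sym (pow-suc p N))
      (∣-trans (*-monoʳ-∣ (+ p) h) (*-monoˡ-∣ (trans-quad α β t) p∣r)))

    -- The values at ± p^(N ∸ μ) differ by 2 u p^N.
    low-valuation : ∀ μ u → β ≡ u · pow p μ → ¬ (+ p ∣ u) → ¬ (2 * μ ≤ N)
    low-valuation μ u refl p∤u 2μ≤N = ¬pow-∣ pp p∤2u {suc N} {N} ℕₚ.≤-refl
      (subst (λ t → pow p (suc N) ∣ t) difference (∣m∣n⇒∣m-n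
        (H₁ J (subst (pow p N ∣_) (plus α P J u) N∣plus)) (H₁ (- J) (subst (pow p N ∣_) (minus α P J u) N∣minus))))
      where
      j = N ∸ μ
      μ≤j : μ ≤ j
      μ≤j = ℕₚ.m+n≤o⇒m≤o∸n μ (subst (λ t → μ ℕ.+ t ≤ N) (ℕₚ.+-identityʳ μ) 2μ≤N)
      P = pow p μ
      J = pow p j
      N≡ : pow p N ≡ P · J
      N≡ = trans (cong (pow p) (sym (ℕₚ.m+[n∸m]≡n (ℕₚ.≤-trans (ℕₚ.m≤m+n μ _) 2μ≤N)))) (pow-+ p μ j)
      p∤2u : ¬ (+ p ∣ + 2 · u)
      p∤2u h = [ p∤2 , p∤u ]′ (euclid pp (+ 2) u h)
      N∣JJ : pow p N ∣ J · J
      N∣JJ = subst (_∣ J · J) (sym N≡) (*-monoˡ-∣ J (pow-mono p μ≤j))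
      N∣PJ : pow p N ∣ P · J
      N∣PJ = ∣-reflexive N≡
      N∣plus : pow p N ∣ α · (J · J) + u · (P · J)
      N∣plus = ∣m∣n⇒∣m+n (∣n⇒∣m*n α N∣JJ) (∣n⇒∣m*n u N∣PJ)
      N∣minus : pow p N ∣ α · (J · J) - u · (P · J)
      N∣minus = ∣m∣n⇒∣m-n (∣n⇒∣m*n α N∣JJ) (∣n⇒∣m*n u N∣PJ)
      plus : ∀ α P J u → α · (J · J) + u · (P · J) ≡ J · (α · J + u · P)
      plus = solve-∀
      minus : ∀ α P J u → α · (J · J) - u · (P · J) ≡ - J · (α · - J + u · P)
      minus = solve-∀
      diff : ∀ α P J u → J · (α · J + u · P) - - J · (α · - J + u · P) ≡ + 2 · u · (P · J)
      diff = solve-∀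
      difference : trans-quad α (u · P) J - trans-quad α (u · P) (- J) ≡ + 2 · u · pow p N
      difference = trans (diff α P J u) (cong (+ 2 · u ·_) (sym N≡))

    -- The value at t = p^h is α p^(2h) up to a multiple of p^(2h+1), when p^(h+1) divides β.
    shallow : ∀ h → pow p (suc h) ∣ β → 2 * h ≤ N → ¬ (pow p (suc N) ∣ trans-quad α β (pow p h))
    shallow h h∣β 2h≤N hyp = ¬pow-∣ pp p∤α {suc (2 * h)} {2 * h} ℕₚ.≤-refl
      (subst (λ t → pow p (suc (2 * h)) ∣ α · t) (sym (pow-double p h))
        (subst (pow p (suc (2 * h)) ∣_) (identity α β (pow p h))
          (∣m∣n⇒∣m-n (∣-trans (pow-mono p (s≤s 2h≤N)) hyp) (lin h h∣β))))
      where
      identity : ∀ α β t → t · (α · t + β) - β · t ≡ α · (t · t)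
      identity = solve-∀
      lin : ∀ h → pow p (suc h) ∣ β → pow p (suc (2 * h)) ∣ β · pow p h
      lin h d = subst (_∣ β · pow p h)
        (trans (sym (pow-+ p (suc h) h)) (cong (λ t → pow p (suc (h ℕ.+ t))) (sym (ℕₚ.+-identityʳ h))))
        (*-monoˡ-∣ (pow p h) d)

    ∣trans-quad : ∀ h → pow p h ∣ β → pow p (2 * h) ∣ trans-quad α β (pow p h)
    ∣trans-quad h h∣β = subst (_∣ trans-quad α β (pow p h)) (sym (pow-double p h))
      (*-monoʳ-∣ (pow p h) (∣m∣n⇒∣m+n (∣n⇒∣m*n α ∣-refl) h∣β))

    result : Evenℕ (suc N) × ¬ (+ p · + p ∣ r) × pow p (suc N) ∣ β · β
    result with parity (suc N)
    ... | h , par with multiplicity-below p β h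
    ...   | inj₁ (μ , μ<h , mult) with multiplicity⇒cofactor mult
    ...     | u , eq , p∤u = contradiction (ℕₚ.≤-pred (2*≤ μ<h par)) (low-valuation μ u eq p∤u)
    result | suc h , inj₂ eq | inj₂ h∣β = contradiction (H₁ (pow p h) N∣) (shallow h h∣β (ℕₚ.≤-reflexive (sym N≡)))
      where
      N≡ : N ≡ 2 * h
      N≡ = ℕₚ.suc-injective (ℕₚ.suc-injective (trans eq (ℕₚ.*-suc 2 h)))
      N∣ : pow p N ∣ trans-quad α β (pow p h)
      N∣ = subst (λ t → pow p t ∣ trans-quad α β (pow p h)) (sym N≡)
        (∣trans-quad h (∣-trans (pow-mono p (ℕₚ.n≤1+n h)) h∣β))
    result | suc h , inj₁ eq | inj₂ h∣β = ℕ∣.divides (suc h) (trans eq (ℕₚ.*-comm 2 (suc h))) , p²∤r , ∣ββ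
      where
      N≡ : suc N ≡ suc (suc (2 * h))
      N≡ = trans eq (ℕₚ.*-suc 2 h)
      ∣ββ : pow p (suc N) ∣ β · β
      ∣ββ = subst (_∣ β · β) (sym (trans (cong (pow p) eq) (pow-double p (suc h))))
        (∣-trans (*-monoʳ-∣ (pow p (suc h)) h∣β) (*-monoˡ-∣ β h∣β))
      p²∤r : ¬ (+ p · + p ∣ r)
      p²∤r p²∣r = shallow h h∣β (ℕₚ.≤-pred (subst (suc (2 * h) ≤_) (sym N≡) (ℕₚ.n≤1+n _)))
        (H (pow p h) (subst (_∣ r · trans-quad α β (pow p h)) (sym suc-N)
          (∣-trans (*-monoʳ-∣ (+ p · + p) (∣trans-quad h (∣-trans (pow-mono p (ℕₚ.n≤1+n h)) h∣β)))
            (*-monoˡ-∣ (trans-quad α β (pow p h)) p²∣r))))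
        where
        suc-N : pow p (suc N) ≡ + p · + p · pow p (2 * h)
        suc-N = trans (cong (pow p) N≡) (trans (pow-suc p (suc (2 * h)))
          (trans (cong (+ p ·_) (pow-suc p (2 * h))) (sym (ℤₚ.*-assoc (+ p) (+ p) (pow p (2 * h))))))

-- Three trial values decide everything. With h half of K rounded up, t = 2^h shows that 2^h does
-- not divide β, so the valuation w of β satisfies 2w < K. At t = 2^(K-w) the square term vanishes
-- modulo 2^(K+2) and leaves u 2^(K+1), which excludes 2w + 2 ≤ K. At t = 2^w the value is (α + 2u)
-- 2^(2w) with α + 2u odd; a factor 2 in r would lift it to 2^K and break the hypothesis.
two-lift : ∀ {α β r K} → ¬ (+ 2 ∣ α) →
  (∀ t → pow 2 K ∣ r · trans-quad α (+ 2 · β) t → pow 2 (suc (suc K)) ∣ trans-quad α (+ 2 · β) t) →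
  ∃[ w ] ∃[ u ] K ≡ suc (2 * w) × β ≡ u · pow 2 w × ¬ (+ 2 ∣ u) × ¬ (+ 2 ∣ r)
two-lift {α} {β} {r} {K} 2∤α H = result
  where
  pp = prime[2]
  Q : ℤ → ℤ
  Q = trans-quad α (+ 2 · β)
  H₁ : ∀ t → pow 2 K ∣ Q t → pow 2 (suc (suc K)) ∣ Q t
  H₁ t h = H t (∣n⇒∣m*n r h)

  high-valuation : ∀ h → (K ≡ 2 * h ⊎ suc K ≡ 2 * h) → ¬ (pow 2 h ∣ β)
  high-valuation h par h∣β = ¬pow-∣ pp 2∤α {suc (2 * h)} {2 * h} ℕₚ.≤-refl
    (subst (λ t → pow 2 (suc (2 * h)) ∣ α · t) (sym (pow-double 2 h))
      (subst (pow 2 (suc (2 * h)) ∣_) (identity α β T) (∣m∣n⇒∣m-n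
        (∣-trans (pow-mono 2 (s≤s (2h≤ par))) (H₁ T (∣-trans (pow-mono 2 (K≤ par)) 2h∣Q))) lin)))
    where
    T = pow 2 h
    2h≤ : (K ≡ 2 * h ⊎ suc K ≡ 2 * h) → 2 * h ≤ suc K
    2h≤ (inj₁ refl) = ℕₚ.n≤1+n _
    2h≤ (inj₂ eq) = ℕₚ.≤-reflexive (sym eq)
    K≤ : (K ≡ 2 * h ⊎ suc K ≡ 2 * h) → K ≤ 2 * h
    K≤ (inj₁ refl) = ℕₚ.≤-refl
    K≤ (inj₂ eq) = subst (K ≤_) eq (ℕₚ.n≤1+n K)
    identity : ∀ α β t → t · (α · t + + 2 · β) - + 2 · (t · β) ≡ α · (t · t)
    identity = solve-∀
    lin : pow 2 (suc (2 * h)) ∣ + 2 · (T · β)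
    lin = subst (_∣ + 2 · (T · β)) (sym (trans (pow-suc 2 (2 * h)) (cong (+ 2 ·_) (pow-double 2 h))))
      (*-monoʳ-∣ (+ 2) (*-monoʳ-∣ T h∣β))
    2h∣Q : pow 2 (2 * h) ∣ Q T
    2h∣Q = subst (_∣ Q T) (sym (pow-double 2 h)) (*-monoʳ-∣ T (∣m∣n⇒∣m+n (∣n⇒∣m*n α ∣-refl) (∣n⇒∣m*n (+ 2) h∣β)))

  low-valuation : ∀ w u → β ≡ u · pow 2 w → ¬ (+ 2 ∣ u) → ¬ (2 ℕ.+ 2 * w ≤ K)
  low-valuation w u refl 2∤u bound = ¬pow-∣ pp 2∤u {suc (suc K)} {suc K} ℕₚ.≤-refl
    (subst (pow 2 (suc (suc K)) ∣_) linear (∣m∣n⇒∣m-n (H₁ J K∣Q) (∣n⇒∣m*n α K+2∣JJ)))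
    where
    j = K ∸ w
    W = pow 2 w
    J = pow 2 j
    2+w+w≤K : 2 ℕ.+ w ℕ.+ w ≤ K
    2+w+w≤K = subst (λ t → 2 ℕ.+ (w ℕ.+ t) ≤ K) (ℕₚ.+-identityʳ w) bound
    2+w≤j : 2 ℕ.+ w ≤ j
    2+w≤j = ℕₚ.m+n≤o⇒m≤o∸n (2 ℕ.+ w) 2+w+w≤K
    w+j≡K : w ℕ.+ j ≡ K
    w+j≡K = ℕₚ.m+[n∸m]≡n (ℕₚ.m+n≤o⇒n≤o (2 ℕ.+ w) 2+w+w≤K)
    K+2∣JJ : pow 2 (suc (suc K)) ∣ J · J
    K+2∣JJ = subst (pow 2 (suc (suc K)) ∣_) (pow-+ 2 j j)
      (pow-mono 2 (subst (_≤ j ℕ.+ j) (cong (2 ℕ.+_) w+j≡K) (ℕₚ.+-monoˡ-≤ j 2+w≤j)))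
    K≡ : pow 2 K ≡ W · J
    K≡ = trans (cong (pow 2) (sym w+j≡K)) (pow-+ 2 w j)
    split : ∀ α u W J → α · (J · J) + + 2 · u · (W · J) ≡ J · (α · J + + 2 · (u · W))
    split = solve-∀
    K∣Q : pow 2 K ∣ Q J
    K∣Q = subst (pow 2 K ∣_) (split α u W J) (∣m∣n⇒∣m+n
      (∣n⇒∣m*n α (∣-trans (pow-mono 2 (ℕₚ.m≤n+m K 2)) K+2∣JJ))
      (∣n⇒∣m*n (+ 2 · u) (∣-reflexive K≡)))
    cancel : ∀ α u W J → J · (α · J + + 2 · (u · W)) - α · (J · J) ≡ u · (+ 2 · (W · J))
    cancel = solve-∀
    linear : Q J - α · (J · J) ≡ u · pow 2 (suc K)
    linear = trans (cancel α u W J) (cong (u ·_) (sym (trans (pow-suc 2 K) (cong (+ 2 ·_) K≡))))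

  r-odd : ∀ w u → β ≡ u · pow 2 w → K ≡ suc (2 * w) → ¬ (+ 2 ∣ r)
  r-odd w u refl refl 2∣r = ¬pow-∣ pp odd {suc (suc K)} {2 * w} (s≤s (ℕₚ.m≤n+m (2 * w) 2))
    (subst (pow 2 (suc (suc K)) ∣_) value (H W (subst (_∣ r · Q W) (sym (pow-suc 2 (2 * w)))
      (∣-trans (*-monoʳ-∣ (+ 2) (divides (α + + 2 · u) value)) (*-monoˡ-∣ (Q W) 2∣r)))))
    where
    W = pow 2 w
    odd : ¬ (+ 2 ∣ α + + 2 · u)
    odd h = 2∤α (∣m+n∣n⇒∣m h (∣m⇒∣m*n u ∣-refl))
    factor : ∀ α u W → W · (α · W + + 2 · (u · W)) ≡ (α + + 2 · u) · (W · W)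
    factor = solve-∀
    value : Q W ≡ (α + + 2 · u) · pow 2 (2 * w)
    value = trans (factor α u W) (cong ((α + + 2 · u) ·_) (sym (pow-double 2 w)))

  result : ∃[ w ] ∃[ u ] K ≡ suc (2 * w) × β ≡ u · pow 2 w × ¬ (+ 2 ∣ u) × ¬ (+ 2 ∣ r)
  result with parity K
  ... | h , par with multiplicity-below 2 β h
  ...   | inj₂ h∣β = contradiction h∣β (high-valuation h par)
  ...   | inj₁ (w , w<h , mult) with multiplicity⇒cofactor mult
  ...     | u , eq , 2∤u = w , u , K≡ , eq , 2∤u , r-odd w u eq K≡
    where
    K≡ : K ≡ suc (2 * w)
    K≡ = ℕₚ.≤-antisym (ℕₚ.≤-pred (ℕₚ.≰⇒> (low-valuation w u eq 2∤u))) (2*≤ w<h par)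

-- Obstructions as missing square roots

-- The shape of s = 2ax + b for a root x: its square is d modulo p^α, and it lies in the class of b
-- because p^β ∣ 2a.
SquareRootAt : (p α β : ℕ) (b d : ℤ) → Set
SquareRootAt p α β b d = ∃[ s ] (pow p α ∣ s · s - d) × (pow p β ∣ s - b)

∣square⇒∣ : ∀ {p K h s} → Prime p → (K ≡ 2 * h ⊎ suc K ≡ 2 * h) → pow p K ∣ s · s → pow p h ∣ s
∣square⇒∣ {p} {K} {h} {s} pp par K∣ss with multiplicity-below p s h
... | inj₂ h∣s = h∣s
... | inj₁ (μ , μ<h , mult) with multiplicity⇒cofactor mult
...   | u , refl , p∤u = contradiction
          (subst (pow p K ∣_) (trans (regroup u (pow p μ)) (cong (u · u ·_) (sym (pow-double p μ)))) K∣ss)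
          (¬pow-∣ pp (λ h → [ p∤u , p∤u ]′ (euclid pp u u h)) (2*≤ μ<h par))
  where
  regroup : ∀ u P → u · P · (u · P) ≡ u · u · (P · P)
  regroup = solve-∀

∣-telescope : ∀ {M} x y {z} → M ∣ x - y → M ∣ y - z → M ∣ x - z
∣-telescope {M} x y {z} p q = subst (M ∣_) (identity x y z) (∣m∣n⇒∣m+n p q)
  where
  identity : ∀ x y z → x - y + (y - z) ≡ x - z
  identity = solve-∀

half≤ : ∀ {α h} → (α ≡ 2 * h ⊎ suc α ≡ 2 * h) → h ≤ α
half≤ {h = h} (inj₁ refl) = ℕₚ.m≤m+n h _
half≤ {α} {suc h} (inj₂ eq) = ℕₚ.≤-trans (ℕₚ.m≤n+m (suc h) h)
  (ℕₚ.≤-reflexive (trans (cong (h ℕ.+_) (sym (ℕₚ.+-identityʳ (suc h)))) (sym (ℕₚ.suc-injective eq))))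

pow-∸ : ∀ p {i j} → i ≤ j → pow p j ≡ pow p (j ∸ i) · pow p i
pow-∸ p {i} {j} i≤j = trans (cong (pow p) (sym (ℕₚ.m∸n+n≡m i≤j))) (pow-+ p (j ∸ i) i)

2*∸ : ∀ {α} μ → 2 * μ ≤ α → α ∸ μ ≡ α ∸ 2 * μ ℕ.+ μ
2*∸ {α} μ le = trans (cong (_∸ μ) (trans (sym (ℕₚ.m∸n+n≡m le))
    (trans (cong (λ t → α ∸ 2 * μ ℕ.+ (μ ℕ.+ t)) (ℕₚ.+-identityʳ μ)) (sym (ℕₚ.+-assoc (α ∸ 2 * μ) μ μ)))))
  (ℕₚ.m+n∸n≡m (α ∸ 2 * μ ℕ.+ μ) μ)

reduced-multiple : ∀ {p α β b} h q → Prime p → β ≤ α → h ≤ α → pow p β ∣ q · pow p h - b →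
  ∃[ i ] i < p ^ (α ∸ h) × (+ (i * p ^ h) ≈ b [mod p ^ β ])
reduced-multiple {p} {α} {β} h q pp β≤α h≤α s≈b = i , ℤ/.n%ℕd<d q (p ^ (α ∸ h)) ,
  ∣-telescope (+ (i * p ^ h)) (q · pow p h) (∣-trans (pow-mono p β≤α) close) s≈b
  where
  instance
    L≢0 : NonZero (p ^ (α ∸ h))
    L≢0 = ℕₚ.m^n≢0 p (α ∸ h) {{prime⇒nonZero pp}}
  i = q ℤ/.%ℕ (p ^ (α ∸ h))
  distrib : ∀ i q P → (i - q) · P ≡ i · P - q · P
  distrib = solve-∀
  close : pow p α ∣ + (i * p ^ h) - q · pow p h
  close = subst₂ _∣_ (sym (pow-∸ p h≤α))
    (trans (distrib (+ i) q (pow p h)) (cong (_- q · pow p h) (sym (ℤₚ.pos-* i (p ^ h)))))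
    (*-monoˡ-∣ (pow p h) (∣-remainder q (p ^ (α ∸ h))))

reduced-root : ∀ {p α β b} μ d₁ q → Prime p → β ≤ α → 2 * μ ≤ α →
  pow p α ∣ q · pow p μ · (q · pow p μ) - d₁ · pow p (2 * μ) → pow p β ∣ q · pow p μ - b →
  ∃₂ λ σ i → σ < p ^ (α ∸ 2 * μ) × (+ σ · + σ ≈ d₁ [mod p ^ (α ∸ 2 * μ) ]) × i < p ^ μ
    × (+ (σ * p ^ μ ℕ.+ i * p ^ (α ∸ μ)) ≈ b [mod p ^ β ])
reduced-root {p} {α} {β} μ d₁ q pp β≤α 2μ≤α s²≈d s≈b =
  σ , i , ℤ/.n%ℕd<d q L , σ²≈d₁ , ℤ/.n%ℕd<d j (p ^ μ) ,
  ∣-telescope (+ (σ * p ^ μ ℕ.+ i * p ^ (α ∸ μ))) (q · P) (∣-trans (pow-mono p β≤α) close) s≈b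
  where
  L = p ^ (α ∸ 2 * μ)
  P = pow p μ
  instance
    L≢0 : NonZero L
    L≢0 = ℕₚ.m^n≢0 p (α ∸ 2 * μ) {{prime⇒nonZero pp}}
    P≢0 : NonZero (p ^ μ)
    P≢0 = ℕₚ.m^n≢0 p μ {{prime⇒nonZero pp}}
  -- Here q = σ + jL, where σ is the canonical solution modulo L. In qP the summand jLP matters only
  -- modulo p^α = LP², so j may be reduced modulo p^μ.
  σ = q ℤ/.%ℕ L
  j = q ℤ/./ℕ L
  i = j ℤ/.%ℕ (p ^ μ)
  factor : ∀ q P d → q · P · (q · P) - d · (P · P) ≡ P · P · (q · q - d)
  factor = solve-∀
  q²≈d₁ : + L ∣ q · q - d₁
  q²≈d₁ = pow-cancel pp (2 * μ) (subst₂ _∣_ (cong (pow p) (sym (ℕₚ.m+[n∸m]≡n 2μ≤α)))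
    (trans (cong (λ t → q · P · (q · P) - d₁ · t) (pow-double p μ))
      (trans (factor q P d₁) (cong (_· (q · q - d₁)) (sym (pow-double p μ))))) s²≈d)
  difference : ∀ s q d → (s - q) · (s + q) + (q · q - d) ≡ s · s - d
  difference = solve-∀
  σ²≈d₁ : + L ∣ + σ · + σ - d₁
  σ²≈d₁ = subst (+ L ∣_) (difference (+ σ) q d₁) (∣m∣n⇒∣m+n (∣m⇒∣m*n (+ σ + q) (∣-remainder q L)) q²≈d₁)
  α≡ : pow p α ≡ P · (+ L · P)
  α≡ = trans (cong (pow p) (trans (sym (ℕₚ.m+[n∸m]≡n (ℕₚ.≤-trans (ℕₚ.m≤m+n μ _) 2μ≤α))) (cong (μ ℕ.+_) (2*∸ μ 2μ≤α))))
    (trans (pow-+ p μ (α ∸ 2 * μ ℕ.+ μ)) (cong (P ·_) (pow-+ p (α ∸ 2 * μ) μ)))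
  expand : ∀ i j s L P → (i - j) · (L · P) ≡ s · P + i · (L · P) - (s + j · L) · P
  expand = solve-∀
  cast : + (σ * p ^ μ ℕ.+ i * p ^ (α ∸ μ)) ≡ + σ · P + + i · (+ L · P)
  cast = trans (ℤₚ.pos-+ (σ * p ^ μ) (i * p ^ (α ∸ μ))) (cong₂ _+_ (ℤₚ.pos-* σ (p ^ μ))
    (trans (ℤₚ.pos-* i (p ^ (α ∸ μ))) (cong (+ i ·_)
      (trans (cong (pow p) (2*∸ μ 2μ≤α)) (pow-+ p (α ∸ 2 * μ) μ)))))
  close : pow p α ∣ + (σ * p ^ μ ℕ.+ i * p ^ (α ∸ μ)) - q · P
  close = subst₂ _∣_ (sym α≡)
    (trans (expand (+ i) j (+ σ) (+ L) P) (cong₂ (λ s t → s - t · P) (sym cast) (sym (ℤ/.a≡a%ℕn+[a/ℕn]*n q L))))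
    (*-monoˡ-∣ (+ L · P) (∣-remainder j (p ^ μ)))

-- A square root of d modulo p^α is divisible by half the power of p in d, or by p^h when d vanishes
-- modulo p^α. Modulo p^α it is therefore one of the enumerated numbers, and β ≤ α carries this over
-- to the congruence modulo p^β.
obstruction⇒¬root : ∀ {p α β b d} → Prime p → β ≤ α → Obstruction p α β b d → ¬ SquareRootAt p α β b d
obstruction⇒¬root {p} {α} {β} {b} {d} pp β≤α (inj₂ (α∣d , h , par , none)) (s , s²≈d , s≈b) =
  refute s (∣square⇒∣ {h = h} {s = s} pp par (∣m+n∣n⇒∣m {n = - d} s²≈d (∣m⇒∣-m α∣d))) s≈b
  where
  refute : ∀ s → pow p h ∣ s → ¬ (pow p β ∣ s - b)
  refute _ (divides q refl) s≈b =
    let i , i< , ≈b = reduced-multiple h q pp β≤α (half≤ par) s≈b in none i i< ≈b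
obstruction⇒¬root {p} {α} {β} {b} pp β≤α (inj₁ (α∤d , μ , d₁ , mult , refl , none)) (s , s²≈d , s≈b) =
  refute s (∣square⇒∣ {h = μ} {s = s} pp (inj₁ refl)
    (∣m+n∣n⇒∣m {n = - (d₁ · pow p (2 * μ))} (∣-trans (pow-mono p 2μ≤α) s²≈d) (∣m⇒∣-m (∣n⇒∣m*n d₁ ∣-refl)))) s²≈d s≈b
  where
  2μ≤α : 2 * μ ≤ α
  2μ≤α = ℕₚ.≮⇒≥ λ α<2μ → α∤d (∣n⇒∣m*n d₁ (pow-mono p (ℕₚ.<⇒≤ α<2μ)))
  refute : ∀ s → pow p μ ∣ s → pow p α ∣ s · s - d₁ · pow p (2 * μ) → ¬ (pow p β ∣ s - b)
  refute _ (divides q refl) s²≈d s≈b =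
    let σ , i , σ< , σ² , i< , ≈b = reduced-root μ d₁ q pp β≤α 2μ≤α s²≈d s≈b in none σ i σ< σ² i< ≈b

reduced-root-square : ∀ {p α} μ d₁ σ i → 2 * μ ≤ α → + σ · + σ ≈ d₁ [mod p ^ (α ∸ 2 * μ) ] →
  let s = + (σ * p ^ μ ℕ.+ i * p ^ (α ∸ μ)) in pow p α ∣ s · s - d₁ · pow p (2 * μ)
reduced-root-square {p} {α} μ d₁ σ i 2μ≤α h = subst₂ (λ x y → x ∣ y · y - d₁ · pow p (2 * μ)) (sym α≡) (sym cast)
  (subst (λ t → L · (P · P) ∣ (+ σ · P + + i · (L · P)) · (+ σ · P + + i · (L · P)) - d₁ · t) (sym (pow-double p μ))
    (subst (L · (P · P) ∣_) (expand (+ σ) (+ i) L P d₁)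
      (∣m∣n⇒∣m+n (*-monoˡ-∣ (P · P) h) (∣n⇒∣m*n (+ 2 · + σ · + i + + i · + i · L) ∣-refl))))
  where
  L = pow p (α ∸ 2 * μ)
  P = pow p μ
  α≡ : pow p α ≡ L · (P · P)
  α≡ = trans (pow-∸ p 2μ≤α) (cong (L ·_) (pow-double p μ))
  cast : + (σ * p ^ μ ℕ.+ i * p ^ (α ∸ μ)) ≡ + σ · P + + i · (L · P)
  cast = trans (ℤₚ.pos-+ (σ * p ^ μ) (i * p ^ (α ∸ μ))) (cong₂ _+_ (ℤₚ.pos-* σ (p ^ μ))
    (trans (ℤₚ.pos-* i (p ^ (α ∸ μ))) (cong (+ i ·_)
      (trans (cong (pow p) (2*∸ μ 2μ≤α)) (pow-+ p (α ∸ 2 * μ) μ)))))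
  expand : ∀ s i L P d → (s · s - d) · (P · P) + (+ 2 · s · i + i · i · L) · (L · (P · P))
    ≡ (s · P + i · (L · P)) · (s · P + i · (L · P)) - d · (P · P)
  expand = solve-∀

divisible-obstruction : ∀ {p α β b d} → pow p α ∣ d → ¬ SquareRootAt p α β b d → Obstruction p α β b d
divisible-obstruction {p} {α} {β} {b} {d} α∣d ¬root = inj₂ (α∣d , h , par , λ i _ ≈b →
  ¬root (+ (i * p ^ h) , ∣m∣n⇒∣m-n (∣-trans (pow-mono p α≤2h) (2h∣ i)) α∣d , ≈b))
  where
  h = proj₁ (parity α)
  par = proj₂ (parity α)
  square : ∀ i P → i · P · (i · P) ≡ i · i · (P · P)
  square = solve-∀
  2h∣ : ∀ i → pow p (2 * h) ∣ + (i * p ^ h) · + (i * p ^ h)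
  2h∣ i = divides (+ i · + i) (trans (cong (λ t → t · t) (ℤₚ.pos-* i (p ^ h)))
    (trans (square (+ i) (pow p h)) (cong (+ i · + i ·_) (sym (pow-double p h)))))
  α≤2h : α ≤ 2 * h
  α≤2h = [ ℕₚ.≤-reflexive , (λ eq → ℕₚ.≤-trans (ℕₚ.n≤1+n α) (ℕₚ.≤-reflexive eq)) ]′ par

-- The first alternative demands an even multiplicity of p in d. It is read off a square root u p^μ
-- of d: since p^α does not divide d, 2μ < α, and then d has the same valuation 2μ as the square.
regular-obstruction : ∀ {p α β b d} μ u Q → Prime p → ¬ (pow p α ∣ d) → ¬ (+ p ∣ u) →
  u · pow p μ · (u · pow p μ) - d ≡ Q · pow p α → ¬ SquareRootAt p α β b d → Obstruction p α β b d
regular-obstruction {p} {α} {β} {b} {d} μ u Q pp α∤d p∤u eq ¬root =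
  inj₁ (α∤d , μ , d₁ , cofactor⇒multiplicity pp p∤d₁ d≡ , d≡ , λ σ i _ σ²≈d₁ _ ≈b →
    ¬root (+ (σ * p ^ μ ℕ.+ i * p ^ (α ∸ μ)) , square σ i σ²≈d₁ , ≈b))
  where
  P = pow p μ
  d-isolated : d ≡ u · P · (u · P) - Q · pow p α
  d-isolated = trans (identity (u · P · (u · P)) d) (cong (λ t → u · P · (u · P) - t) eq)
    where
    identity : ∀ s d → d ≡ s - (s - d)
    identity = solve-∀
  PP∣s² : P · P ∣ u · P · (u · P)
  PP∣s² = divides (u · u) (identity u P)
    where
    identity : ∀ u P → u · P · (u · P) ≡ u · u · (P · P)
    identity = solve-∀
  2μ<α : 2 * μ < α
  2μ<α = ℕₚ.≰⇒> λ α≤2μ → α∤d (subst (pow p α ∣_) (sym d-isolated)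
    (∣m∣n⇒∣m-n (∣-trans (subst (pow p α ∣_) (pow-double p μ) (pow-mono p α≤2μ)) PP∣s²) (∣n⇒∣m*n Q ∣-refl)))
  L = pow p (α ∸ 2 * μ)
  d₁ = u · u - Q · L
  factor : ∀ u P Q L → u · P · (u · P) - Q · (L · (P · P)) ≡ (u · u - Q · L) · (P · P)
  factor = solve-∀
  d≡ : d ≡ d₁ · pow p (2 * μ)
  d≡ = trans d-isolated
    (trans (cong (λ t → u · P · (u · P) - Q · t) (trans (pow-∸ p (ℕₚ.<⇒≤ 2μ<α)) (cong (L ·_) (pow-double p μ))))
      (trans (factor u P Q L) (cong (d₁ ·_) (sym (pow-double p μ)))))
  p∤d₁ : ¬ (+ p ∣ d₁)
  p∤d₁ h = [ p∤u , p∤u ]′ (euclid pp u u (∣m+n∣n⇒∣m h (∣m⇒∣-m (∣n⇒∣m*n Q (∣pow p (ℕₚ.m<n⇒0<n∸m 2μ<α))))))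
  square : ∀ σ i → + σ · + σ ≈ d₁ [mod p ^ (α ∸ 2 * μ) ] →
    let s = + (σ * p ^ μ ℕ.+ i * p ^ (α ∸ μ)) in pow p α ∣ s · s - d
  square σ i h = subst (λ t → pow p α ∣ + (σ * p ^ μ ℕ.+ i * p ^ (α ∸ μ)) · + (σ * p ^ μ ℕ.+ i * p ^ (α ∸ μ)) - t)
    (sym d≡) (reduced-root-square μ d₁ σ i (ℕₚ.<⇒≤ 2μ<α) h)

-- Some square root of d is required to start from: an odd multiplicity of p in d below α would
-- leave no square root and yet no obstruction.
¬root⇒obstruction : ∀ {p α β b d} → Prime p → QuadraticResidue d (p ^ α) →
  ¬ SquareRootAt p α β b d → Obstruction p α β b d
¬root⇒obstruction {p} {α} {β} {b} {d} pp (s , s²≈d) ¬root with pow p α ∣? d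
... | yes α∣d = divisible-obstruction {p} {α} {β} {b} {d} α∣d ¬root
... | no α∤d = cases (multiplicity-below p s α)
  where
  identity : ∀ s d → s · s - (s · s - d) ≡ d
  identity = solve-∀
  rewrite-root : ∀ {t} → s ≡ t → t · t - d ≡ _∣_.quotient s²≈d · pow p α
  rewrite-root refl = _∣_.equality s²≈d
  cases : (∃[ μ ] μ < α × IsMultiplicity p μ s) ⊎ (pow p α ∣ s) → Obstruction p α β b d
  cases (inj₂ α∣s) = contradiction (subst (pow p α ∣_) (identity s d) (∣m∣n⇒∣m-n (∣m⇒∣m*n s α∣s) s²≈d)) α∤d
  cases (inj₁ (μ , _ , mult)) = let u , s≡ , p∤u = multiplicity⇒cofactor mult in
    regular-obstruction {p} {α} {β} {b} {d} μ u (_∣_.quotient s²≈d) pp α∤d p∤u (rewrite-root s≡) ¬root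

-- Roots and the validity of IQF

record Reduction (a : ℤ) (n r k m : ℕ) : Set where
  field
    a′   : ℤ
    a≡   : a ≡ a′ · + r
    n≡   : + n ≡ + m · pow 2 k · + r
    a′⟂  : a′ ⟂ + m · pow 2 k
    2∤m  : ¬ (+ 2 ∣ + m)
    r≢0  : NonZero r
    a≢0  : a ≢ + 0

completed-square : ∀ a b c x →
  (+ 2 · a · x + b) · (+ 2 · a · x + b) - (b · b - + 4 · a · c) ≡ + 4 · a · (a · x · x + b · x + c)
completed-square = solve-∀

∣2⇒≡2 : ∀ {p} → Prime p → + p ∣ + 2 → p ≡ 2
∣2⇒≡2 pp h = [ (λ { refl → contradiction pp ¬prime[1] }) , (λ eq → eq) ]′ (prime⇒irreducible prime[2] (∣⇒∣ᵤ h))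

2-⟂ : ∀ {m} → ¬ (+ 2 ∣ m) → m ⟂ + 2
2-⟂ 2∤m = ⟂-sym (prime-⟂ prime[2] 2∤m)

cancel-twos : ∀ P x y → + 2 · (+ 2 · P) ∣ x · + 2 · (y · + 2) → P ∣ x · y
cancel-twos P x y h = *-cancelˡ-∣ (+ 2) {P} {x · y} (*-cancelˡ-∣ (+ 2) {+ 2 · P} {+ 2 · (x · y)}
  (subst (+ 2 · (+ 2 · P) ∣_) (regroup x y) h))
  where
  regroup : ∀ x y → x · + 2 · (y · + 2) ≡ + 2 · (+ 2 · (x · y))
  regroup = solve-∀

module Setting {a n r k m} (R : Reduction a n r k m) (b c : ℤ) where
  open Reduction R

  F : ℤ → ℤ
  F = quad a b c

  d : ℤ
  d = discriminant a b c

  Root : ℤ → Set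
  Root x = + m · pow 2 k ∣ + 4 · F x

  m⟂2 : + m ⟂ + 2
  m⟂2 = 2-⟂ 2∤m

  m⟂4 : + m ⟂ + 4
  m⟂4 = ⟂-·ʳ m⟂2 m⟂2

  root⇒m∣ : ∀ x → Root x → + m ∣ F x
  root⇒m∣ x h = ⟂-cancel m⟂4 (∣-trans (∣m⇒∣m*n (pow 2 k) ∣-refl) h)

  root⇒n∣4aF : ∀ x → Root x → + n ∣ + 4 · a · F x
  root⇒n∣4aF x h = subst₂ _∣_ (sym n≡) (trans (regroup a′ (+ r) (F x)) (cong (λ t → + 4 · t · F x) (sym a≡)))
    (∣n⇒∣m*n a′ (*-monoˡ-∣ (+ r) h))
    where
    regroup : ∀ a r f → a · (+ 4 · f · r) ≡ + 4 · (a · r) · f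
    regroup = solve-∀

  n∣4aF⇒root : ∀ x → + n ∣ + 4 · a · F x → Root x
  n∣4aF⇒root x h = ⟂-cancel (⟂-sym a′⟂) (*-cancelʳ-∣ (+ r) {{r≢0}}
    (subst₂ _∣_ n≡ (trans (cong (λ t → + 4 · t · F x) a≡) (regroup a′ (+ r) (F x))) h))
    where
    regroup : ∀ a r f → + 4 · (a · r) · f ≡ a · (+ 4 · f) · r
    regroup = solve-∀

  F≈0⇔ : ∀ x → (F x ≈ + 0 [mod n ] → + n ∣ F x) × (+ n ∣ F x → F x ≈ + 0 [mod n ])
  F≈0⇔ x = subst (+ n ∣_) (ℤₚ.+-identityʳ (F x)) , subst (+ n ∣_) (sym (ℤₚ.+-identityʳ (F x)))

  n∣4aF⇒residue : ∀ x → + n ∣ + 4 · a · F x →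
    ∃[ s ] (s · s ≈ d [mod n ]) × (+ 2 · a · x ≈ - b + s [mod n ])
  n∣4aF⇒residue x h = + 2 · a · x + b , subst (+ n ∣_) (sym (completed-square a b c x)) h ,
    subst (+ n ∣_) (sym (cancel (+ 2 · a · x) b)) (divides (+ 0) refl)
    where
    cancel : ∀ t b → t - (- b + (t + b)) ≡ + 0
    cancel = solve-∀

  residue⇒n∣4aF : ∀ x s → s · s ≈ d [mod n ] → + 2 · a · x ≈ - b + s [mod n ] → + n ∣ + 4 · a · F x
  residue⇒n∣4aF x s s²≈d s≈ = subst (+ n ∣_) (completed-square a b c x)
    (subst (+ n ∣_) (difference (+ 2 · a · x) b s d) (∣m∣n⇒∣m+n (∣m⇒∣m*n (+ 2 · a · x + b + s) s≈) s²≈d))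
    where
    difference : ∀ t b s d → (t - (- b + s)) · (t + b + s) + (s · s - d) ≡ (t + b) · (t + b) - d
    difference = solve-∀

  root⇒residue : ∀ x → Root x → QuadraticResidue d n
  root⇒residue x h = let s , s²≈d , _ = n∣4aF⇒residue x (root⇒n∣4aF x h) in s , s²≈d

  valid⇒ : IQFValid a b c n → ∀ x → Root x → + n ∣ F x
  valid⇒ valid x h = proj₁ (F≈0⇔ x) (Equivalence.from (valid x) (n∣4aF⇒residue x (root⇒n∣4aF x h)))

  ⇒valid : (∀ x → Root x → + n ∣ F x) → IQFValid a b c n
  ⇒valid H x = mk⇔ (n∣4aF⇒residue x ∘ ∣n⇒∣m*n (+ 4 · a) ∘ proj₁ (F≈0⇔ x))
    (λ (s , s²≈d , s≈) → proj₂ (F≈0⇔ x) (H x (n∣4aF⇒root x (residue⇒n∣4aF x s s²≈d s≈))))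

  -- At a root, 2ax + b would be a square root of d of the forbidden kind: its square differs from d
  -- by 4aF, and p^α divides that because m ∣ F, respectively because 2^k m ∣ 4F.
  condition-i⇒¬root : Condition-i a b d k m → ∀ x → ¬ Root x
  condition-i⇒¬root (p , α , β , pp , _ , (β∣2a , _) , α-mult , _ , β<α , _ , _ , obstruction) x h =
    obstruction⇒¬root pp (ℕₚ.<⇒≤ β<α) obstruction
      ( + 2 · a · x + b
      , subst (pow p α ∣_) (sym (completed-square a b c x)) (α∣ α-mult)
      , subst (pow p β ∣_) (sym (cancel (+ 2 · a · x) b)) (∣m⇒∣m*n x β∣2a) )
    where
    cancel : ∀ t b → t + b - b ≡ t
    cancel = solve-∀
    regroup : ∀ t a f → + 4 · f · a ≡ + 4 · a · f
    regroup = solve-∀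
    regroup′ : ∀ t a m → t · a · m ≡ m · t · a
    regroup′ = solve-∀
    α∣ : (k ≤ 2 × IsMultiplicity p α (+ 4 · a · + m)) ⊎ (3 ≤ k × IsMultiplicity p α (+ (2 ^ k) · a · + m)) →
      pow p α ∣ + 4 · a · F x
    α∣ (inj₁ (_ , α∣4am , _)) = ∣-trans α∣4am (*-monoʳ-∣ (+ 4 · a) (root⇒m∣ x h))
    α∣ (inj₂ (_ , α∣2ᵏam , _)) = ∣-trans (subst (pow p α ∣_) (regroup′ (pow 2 k) a (+ m)) α∣2ᵏam)
      (subst (+ m · pow 2 k · a ∣_) (regroup (+ 0) a (F x)) (*-monoˡ-∣ a h))

  -- From a missing local root to condition (i)

  module Local {p β e u} (pp : Prime p) (2a≡ : + 2 · a ≡ u · pow p β) (p∤u : ¬ (+ p ∣ u)) (1≤e : 1 ≤ e)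
    (¬local : ¬ (∃[ x ] pow p e ∣ + 2 · F x)) where

    -- Given such an s with s - b = t p^β, solving ux ≡ t modulo p^e makes 2ax + b congruent to s
    -- modulo p^(β+e). Then p^(β+e) divides 4aF = u p^β · 2F, so p^e ∣ 2F, which is excluded.
    ¬square-root : ¬ SquareRootAt p (β ℕ.+ e) β b d
    ¬square-root (s , s²≈d , divides t s-b≡) = ¬local (x , ⟂-cancel (pow-⟂ pp p∤u e) (pow-cancel pp β 4aF))
      where
      sol = ⟂-solve (⟂-sym (pow-⟂ pp p∤u e)) t
      x = proj₁ sol
      y = + 2 · a · x + b
      expand : ∀ t b s x → t · x + b - s ≡ t · x - (s - b)
      expand = solve-∀
      factor : ∀ u P x t → u · P · x - t · P ≡ P · (u · x - t)
      factor = solve-∀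
      y≈s : pow p (β ℕ.+ e) ∣ y - s
      y≈s = subst₂ _∣_ (sym (pow-+ p β e))
        (sym (trans (expand (+ 2 · a) b s x) (trans (cong₂ (λ v w → v · x - w) 2a≡ s-b≡) (factor u (pow p β) x t))))
        (*-monoʳ-∣ (pow p β) (proj₂ sol))
      difference : ∀ y s d → (y - s) · (y + s) + (s · s - d) ≡ y · y - d
      difference = solve-∀
      regroup : ∀ a f → + 4 · a · f ≡ + 2 · a · (+ 2 · f)
      regroup = solve-∀
      regroup′ : ∀ u P f → u · P · f ≡ P · (u · f)
      regroup′ = solve-∀
      4aF : pow p (β ℕ.+ e) ∣ pow p β · (u · (+ 2 · F x))
      4aF = subst (pow p (β ℕ.+ e) ∣_)
        (trans (completed-square a b c x) (trans (regroup a (F x))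
          (trans (cong (_· (+ 2 · F x)) 2a≡) (regroup′ u (pow p β) (+ 2 · F x)))))
        (subst (pow p (β ℕ.+ e) ∣_) (difference y s d) (∣m∣n⇒∣m+n (∣m⇒∣m*n (y + s) y≈s) s²≈d))

    2β∣4ac : + 2 · pow p β ∣ + 4 · a · c
    2β∣4ac = divides (u · c) (trans (regroup a c) (trans (cong (λ t → t · (+ 2 · c)) 2a≡) (regroup′ u (pow p β) c)))
      where
      regroup : ∀ a c → + 4 · a · c ≡ + 2 · a · (+ 2 · c)
      regroup = solve-∀
      regroup′ : ∀ u P c → u · P · (+ 2 · c) ≡ u · c · (+ 2 · P)
      regroup′ = solve-∀

    β∣4ac : pow p β ∣ + 4 · a · c
    β∣4ac = ∣-trans (∣n⇒∣m*n (+ 2) ∣-refl) 2β∣4ac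

    module _ (s : ℤ) (s²≈d : pow p (β ℕ.+ e) ∣ s · s - d) where

      ∣conjugates : ∀ {M} → M ∣ pow p (β ℕ.+ e) → M ∣ + 4 · a · c → M ∣ (s - b) · (s + b)
      ∣conjugates {M} M∣ M∣4ac = subst (M ∣_) (identity s b (+ 4 · a · c)) (∣m∣n⇒∣m-n (∣-trans M∣ s²≈d) M∣4ac)
        where
        identity : ∀ s b t → s · s - (b · b - t) - t ≡ (s - b) · (s + b)
        identity = solve-∀

      -- The source of the side conditions of (i). Both s and -s are square roots of d and neither
      -- is congruent to b, so p^β divides this product but neither of its factors. For β ≤ 1 that
      -- is impossible, and in general p must divide both factors.
      β∣conjugates : pow p β ∣ (s - b) · (s + b)
      β∣conjugates = ∣conjugates (pow-mono p (ℕₚ.m≤m+n β e)) β∣4ac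

      β∤s-b : ¬ (pow p β ∣ s - b)
      β∤s-b h = ¬square-root (s , s²≈d , h)

      β∤s+b : ¬ (pow p β ∣ s + b)
      β∤s+b h = ¬square-root (- s , subst (λ t → pow p (β ℕ.+ e) ∣ t - d) (square s) s²≈d ,
        subst (pow p β ∣_) (negate s b) (∣m⇒∣-m h))
        where
        square : ∀ s → s · s ≡ - s · - s
        square = solve-∀
        negate : ∀ s b → - (s + b) ≡ - s - b
        negate = solve-∀

      1<β : 1 < β
      1<β = ℕₚ.≤∧≢⇒< (ℕₚ.n≢0⇒n>0 β≢0) (β≢1 ∘ sym)
        where
        β≢0 : β ≢ 0
        β≢0 refl = β∤s-b (divides (s - b) (sym (ℤₚ.*-identityʳ _)))
        β≢1 : β ≢ 1
        β≢1 refl = [ β∤s-b ∘ lift , β∤s+b ∘ lift ]′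
          (euclid pp (s - b) (s + b) (subst (_∣ (s - b) · (s + b)) (pow-1 p) β∣conjugates))
          where
          lift : ∀ {z} → + p ∣ z → pow p 1 ∣ z
          lift {z} = subst (_∣ z) (sym (pow-1 p))

      sum-conjugates : ∀ s b → s + b - (s - b) ≡ + 2 · b
      sum-conjugates = solve-∀

      p∣b-odd : ¬ (+ p ∣ + 2) → + p ∣ b
      p∣b-odd p∤2 with + p ∣? s - b | + p ∣? s + b
      ... | no p∤s-b | _ = contradiction (⟂-cancel (pow-⟂ pp p∤s-b β) β∣conjugates) β∤s+b
      ... | yes _ | no p∤s+b = contradiction
              (⟂-cancel (pow-⟂ pp p∤s+b β) (subst (pow p β ∣_) (ℤₚ.*-comm (s - b) (s + b)) β∣conjugates)) β∤s-b
      ... | yes p∣s-b | yes p∣s+b = [ (λ h → contradiction h p∤2) , (λ h → h) ]′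
              (euclid pp (+ 2) b (subst (+ p ∣_) (sum-conjugates s b) (∣m∣n⇒∣m-n p∣s+b p∣s-b)))

    module Even (p≡2 : p ≡ 2) (s : ℤ) (s²≈d : pow p (β ℕ.+ e) ∣ s · s - d) where

      -- For p = 2, two even conjugates only give 2 ∣ 2b. The additional factor 2, available because
      -- e ≥ 1 and 2 · 2^β ∣ 4ac, lets both conjugates be halved: 2^(β-1) divides v(v + b) but
      -- neither factor, so v and v + b are both even, and with them b.
      2β∣conjugates : + 2 · pow p β ∣ (s - b) · (s + b)
      2β∣conjugates = ∣conjugates s s²≈d (subst (_∣ pow p (β ℕ.+ e)) suc-β
          (pow-mono p (subst (_≤ β ℕ.+ e) (ℕₚ.+-comm β 1) (ℕₚ.+-monoʳ-≤ β 1≤e)))) 2β∣4ac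
        where
        suc-β : pow p (suc β) ≡ + 2 · pow p β
        suc-β = trans (pow-suc p β) (cong (λ t → + t · pow p β) p≡2)

      2∣conjugate : + 2 ∣ s - b
      2∣conjugate = [ (λ h → h) , (λ h → subst (+ 2 ∣_) (identity s b) (∣m∣n⇒∣m-n h (∣m⇒∣m*n b ∣-refl))) ]′
        (euclid prime[2] (s - b) (s + b) (∣-trans (∣m⇒∣m*n (pow p β) ∣-refl) 2β∣conjugates))
        where
        identity : ∀ s b → s + b - + 2 · b ≡ s - b
        identity = solve-∀

      module _ (1≤β : 1 ≤ β) (v : ℤ) (s-b≡ : s - b ≡ v · + 2) where
        β′ = β ∸ 1
        half : pow p β ≡ + 2 · pow p β′
        half = trans (cong (pow p) (sym (ℕₚ.m+[n∸m]≡n 1≤β))) (trans (pow-suc p β′) (cong (λ t → + t · pow p β′) p≡2))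
        s+b≡ : s + b ≡ (v + b) · + 2
        s+b≡ = trans (identity s b) (trans (cong (_+ + 2 · b) s-b≡) (identity′ v b))
          where
          identity : ∀ s b → s + b ≡ s - b + + 2 · b
          identity = solve-∀
          identity′ : ∀ v b → v · + 2 + + 2 · b ≡ (v + b) · + 2
          identity′ = solve-∀
        halves : pow p β′ ∣ v · (v + b)
        halves = cancel-twos (pow p β′) v (v + b)
          (subst₂ _∣_ (cong (+ 2 ·_) half) (cong₂ _·_ s-b≡ s+b≡) 2β∣conjugates)
        2∤⇒⟂ : ∀ z → ¬ (+ 2 ∣ z) → pow p β′ ⟂ z
        2∤⇒⟂ z 2∤z = pow-⟂ pp (subst (λ t → ¬ (+ t ∣ z)) (sym p≡2) 2∤z) β′
        double : ∀ z w → w ≡ z · + 2 → pow p β′ ∣ z → pow p β ∣ w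
        double z w w≡ h = subst₂ _∣_ (sym half) (trans (ℤₚ.*-comm (+ 2) z) (sym w≡)) (*-monoʳ-∣ (+ 2) h)
        by-parity : Dec (+ 2 ∣ v) → Dec (+ 2 ∣ v + b) → + 2 ∣ b
        by-parity (yes 2∣v) (yes 2∣v+b) = ∣m+n∣m⇒∣n 2∣v+b 2∣v
        by-parity (no 2∤v) _ = contradiction
          (double (v + b) (s + b) s+b≡ (⟂-cancel (2∤⇒⟂ v 2∤v) halves)) (β∤s+b s s²≈d)
        by-parity _ (no 2∤v+b) = contradiction
          (double v (s - b) s-b≡ (⟂-cancel (2∤⇒⟂ (v + b) 2∤v+b) (subst (pow p β′ ∣_) (ℤₚ.*-comm v (v + b)) halves)))
          (β∤s-b s s²≈d)

      p∣b-even : 1 ≤ β → + 2 ∣ b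
      p∣b-even 1≤β = by-parity 1≤β v (_∣_.equality 2∣conjugate) (+ 2 ∣? v) (+ 2 ∣? (v + b))
        where v = _∣_.quotient 2∣conjugate

    p∣b : ∀ s → pow p (β ℕ.+ e) ∣ s · s - d → + p ∣ b
    p∣b s s²≈d with + p ∣? + 2
    ... | no p∤2 = p∣b-odd s s²≈d p∤2
    ... | yes p∣2 = subst (λ t → + t ∣ b) (sym p≡2) (Even.p∣b-even p≡2 s s²≈d (ℕₚ.<⇒≤ (1<β s s²≈d)))
      where p≡2 = ∣2⇒≡2 pp p∣2

    p²∣d : ∀ s → pow p (β ℕ.+ e) ∣ s · s - d → + (p ^ 2) ∣ d
    p²∣d s s²≈d = ∣m∣n⇒∣m-n (subst (_∣ b · b) (sym p²≡) (∣-trans (*-monoʳ-∣ (+ p) (p∣b s s²≈d)) (*-monoˡ-∣ b (p∣b s s²≈d))))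
      (∣-trans (pow-mono p (1<β s s²≈d)) β∣4ac)
      where
      p²≡ : pow p 2 ≡ + p · + p
      p²≡ = trans (pow-suc p 1) (cong (+ p ·_) (pow-1 p))

    p∣2a : 1 ≤ β → + p ∣ + 2 · a
    p∣2a 1≤β = subst (+ p ∣_) (sym 2a≡) (∣n⇒∣m*n u (∣pow p 1≤β))

    condition-i : QuadraticResidue d (p ^ (β ℕ.+ e)) →
      (k ≤ 2 × IsMultiplicity p (β ℕ.+ e) (+ 4 · a · + m))
        ⊎ (3 ≤ k × IsMultiplicity p (β ℕ.+ e) (+ (2 ^ k) · a · + m)) →
      Condition-i a b d k m
    condition-i (s , s²≈d) α-mult =
      p , β ℕ.+ e , β , pp , p∣2a (ℕₚ.<⇒≤ (1<β s s²≈d)) , cofactor⇒multiplicity pp p∤u 2a≡ , α-mult ,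
      1<β s s²≈d , ℕₚ.m<m+n β 1≤e , p∣b s s²≈d , p²∣d s s²≈d ,
      ¬root⇒obstruction {p} {β ℕ.+ e} {β} {b} {d} pp (s , s²≈d) ¬square-root

double-quad : ∀ a b c x → (+ 2 · a) · x · x + (+ 2 · b) · x + + 2 · c ≡ + 2 · (a · x · x + b · x + c)
double-quad = solve-∀

residue-∣ : ∀ {d M N} → + M ∣ + N → QuadraticResidue d N → QuadraticResidue d M
residue-∣ M∣N (s , h) = s , ∣-trans M∣N h

module _ {a n r k m} (R : Reduction a n r k m) (b c : ℤ) where
  open Reduction R
  open Setting R b c

  private
    1≤m : 1 ≤ m
    1≤m = ℕₚ.n≢0⇒n>0 λ { refl → 2∤m (divides (+ 0) refl) }

    2N≡ : 3 ≤ k → + 2 · + (2 ^ (k ∸ 1) * m) ≡ + m · pow 2 k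
    2N≡ 3≤k = trans (cong (+ 2 ·_) (ℤₚ.pos-* (2 ^ (k ∸ 1)) m)) (trans (regroup (pow 2 (k ∸ 1)) (+ m))
      (cong (+ m ·_) (trans (sym (pow-suc 2 (k ∸ 1))) (cong (pow 2) (ℕₚ.m+[n∸m]≡n (ℕₚ.≤-trans (s≤s z≤n) 3≤k))))))
      where
      regroup : ∀ t m → + 2 · (t · m) ≡ m · (+ 2 · t)
      regroup = solve-∀

    ∣2F : ∀ {M} x → M ∣ quad (+ 2 · a) (+ 2 · b) (+ 2 · c) x → M ∣ + 2 · F x
    ∣2F {M} x = subst (M ∣_) (double-quad a b c x)

    2F∣ : ∀ {M} → ∃[ x ] M ∣ + 2 · F x → ∃[ x ] M ∣ quad (+ 2 · a) (+ 2 · b) (+ 2 · c) x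
    2F∣ {M} (x , h) = x , subst (M ∣_) (sym (double-quad a b c x)) h

    2a≢0 : + 2 · a ≢ + 0
    2a≢0 h = a≢0 (ℤₚ.*-cancelˡ-≡ (+ 2) a (+ 0) h)

    p∤a′ : ∀ {p} → Prime p → + p ∣ + m · pow 2 k → ¬ (+ p ∣ a′)
    p∤a′ pp p∣ = ⟂⇒∤ pp (⟂-sym (⟂-∣ʳ a′⟂ p∣))

    pow∣2r : ∀ {p β u} → Prime p → + p ∣ + m · pow 2 k → + 2 · a ≡ u · pow p β → pow p β ∣ + 2 · + r
    pow∣2r {p} {β} {u} pp p∣ 2a≡ = ⟂-cancel (pow-⟂ pp (p∤a′ pp p∣) β)
      (subst (pow p β ∣_) (trans (sym 2a≡) (trans (cong (+ 2 ·_) a≡) (regroup a′ (+ r)))) (∣n⇒∣m*n u ∣-refl))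
      where
      regroup : ∀ a r → + 2 · (a · r) ≡ a · (+ 2 · r)
      regroup = solve-∀

    pow-e∣ : ∀ p e {M} M′ → M ≡ M′ * p ^ e → pow p e ∣ + M
    pow-e∣ p e {M} M′ M≡ = divides (+ M′) (trans (cong +_ M≡) (ℤₚ.pos-* M′ (p ^ e)))

  -- The prime divides m, hence is odd, and p^β ∣ 2r gives p^β ∣ r. Thus p^(β+e) ∣ rm ∣ n, and the
  -- square root of d modulo n serves modulo p^α.
  small-k : k ≤ 2 → LocalObstacle (+ 2 · a) (+ 2 · b) (+ 2 · c) m → QuadraticResidue d n → Condition-i a b d k m
  small-k k≤2 (p , e , M′ , pp , 1≤e , m≡ , p∤M′ , ¬root) residue =
    Local.condition-i {p} {β} {e} {u} pp 2a≡ p∤u 1≤e (¬root ∘ 2F∣)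
      (residue-∣ {d} {p ^ (β ℕ.+ e)} {n} α∣n residue)
      (inj₁ (k≤2 , cofactor⇒multiplicity pp p∤2uM′ 4am≡))
    where
    mult = multiplicity pp 2a≢0
    β = proj₁ mult
    cof = multiplicity⇒cofactor (proj₂ mult)
    u = proj₁ cof
    2a≡ : + 2 · a ≡ u · pow p β
    2a≡ = proj₁ (proj₂ cof)
    p∤u : ¬ (+ p ∣ u)
    p∤u = proj₂ (proj₂ cof)
    p∣m : + p ∣ + m
    p∣m = ∣-trans (∣pow p 1≤e) (pow-e∣ p e M′ m≡)
    p∤2 : ¬ (+ p ∣ + 2)
    p∤2 h = 2∤m (subst (λ t → + t ∣ + m) (∣2⇒≡2 pp h) p∣m)
    regroup : ∀ u P M Q → + 2 · (u · P) · (M · Q) ≡ + 2 · u · M · (P · Q)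
    regroup = solve-∀
    regroup₂ : ∀ a m → + 4 · a · m ≡ + 2 · (+ 2 · a) · m
    regroup₂ = solve-∀
    4am≡ : + 4 · a · + m ≡ + 2 · u · + M′ · pow p (β ℕ.+ e)
    4am≡ = trans (regroup₂ a (+ m)) (trans (cong₂ (λ s t → + 2 · s · t) 2a≡ (trans (cong +_ m≡) (ℤₚ.pos-* M′ (p ^ e))))
      (trans (regroup u (pow p β) (+ M′) (pow p e)) (cong (+ 2 · u · + M′ ·_) (sym (pow-+ p β e)))))
    p∤2uM′ : ¬ (+ p ∣ + 2 · u · + M′)
    p∤2uM′ h = [ [ p∤2 , p∤u ]′ ∘ euclid pp (+ 2) u , p∤M′ ]′ (euclid pp (+ 2 · u) (+ M′) h)
    β∣r : pow p β ∣ + r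
    β∣r = ⟂-cancel (pow-⟂ pp p∤2 β) (pow∣2r {p} {β} {u} pp (∣m⇒∣m*n (pow 2 k) p∣m) 2a≡)
    regroup₃ : ∀ r m t → r · m · t ≡ m · t · r
    regroup₃ = solve-∀
    α∣n : pow p (β ℕ.+ e) ∣ + n
    α∣n = subst₂ _∣_ (sym (pow-+ p β e)) (trans (regroup₃ (+ r) (+ m) (pow 2 k)) (sym n≡))
      (∣m⇒∣m*n (pow 2 k) (∣-trans (*-monoʳ-∣ (pow p β) (pow-e∣ p e M′ m≡)) (*-monoˡ-∣ (+ m) β∣r)))

  -- Now p may be 2. With N = 2^(k-1) m one has 2^k a m = 2a · N and n = 2r · N, so p^β ∣ 2r and p^e
  -- ∣ N give p^(β+e) ∣ n.
  large-k : 3 ≤ k → LocalObstacle (+ 2 · a) (+ 2 · b) (+ 2 · c) (2 ^ (k ∸ 1) * m) →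
    QuadraticResidue d n → Condition-i a b d k m
  large-k 3≤k (p , e , M′ , pp , 1≤e , N≡ , p∤M′ , ¬root) residue =
    Local.condition-i {p} {β} {e} {u} pp 2a≡ p∤u 1≤e (¬root ∘ 2F∣)
      (residue-∣ {d} {p ^ (β ℕ.+ e)} {n} α∣n residue)
      (inj₂ (3≤k , cofactor⇒multiplicity pp p∤uM′ 2ᵏam≡))
    where
    N = 2 ^ (k ∸ 1) * m
    mult = multiplicity pp 2a≢0
    β = proj₁ mult
    cof = multiplicity⇒cofactor (proj₂ mult)
    u = proj₁ cof
    2a≡ : + 2 · a ≡ u · pow p β
    2a≡ = proj₁ (proj₂ cof)
    p∤u : ¬ (+ p ∣ u)
    p∤u = proj₂ (proj₂ cof)
    p∣ : + p ∣ + m · pow 2 k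
    p∣ = subst (+ p ∣_) (2N≡ 3≤k) (∣n⇒∣m*n (+ 2) (∣-trans (∣pow p 1≤e) (pow-e∣ p e M′ N≡)))
    regroup : ∀ u P M Q → u · P · (M · Q) ≡ u · M · (P · Q)
    regroup = solve-∀
    regroup₂ : ∀ a m t → t · a · m ≡ a · (m · t)
    regroup₂ = solve-∀
    regroup₃ : ∀ a N → a · (+ 2 · N) ≡ + 2 · a · N
    regroup₃ = solve-∀
    2ᵏam≡ : + (2 ^ k) · a · + m ≡ u · + M′ · pow p (β ℕ.+ e)
    2ᵏam≡ = trans (regroup₂ a (+ m) (pow 2 k)) (trans (cong (a ·_) (sym (2N≡ 3≤k))) (trans (regroup₃ a (+ N))
      (trans (cong₂ _·_ 2a≡ (trans (cong +_ N≡) (ℤₚ.pos-* M′ (p ^ e))))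
        (trans (regroup u (pow p β) (+ M′) (pow p e)) (cong (u · + M′ ·_) (sym (pow-+ p β e)))))))
    p∤uM′ : ¬ (+ p ∣ u · + M′)
    p∤uM′ h = [ p∤u , p∤M′ ]′ (euclid pp u (+ M′) h)
    regroup₄ : ∀ r N → + 2 · r · N ≡ + 2 · N · r
    regroup₄ = solve-∀
    α∣n : pow p (β ℕ.+ e) ∣ + n
    α∣n = subst₂ _∣_ (sym (pow-+ p β e)) (trans (regroup₄ (+ r) (+ N)) (trans (cong (_· + r) (2N≡ 3≤k)) (sym n≡)))
      (∣-trans (*-monoʳ-∣ (pow p β) (pow-e∣ p e M′ N≡)) (*-monoˡ-∣ (+ N) (pow∣2r {p} {β} {u} pp p∣ 2a≡)))

  small-k-root : k ≤ 2 → ∀ x → + m ∣ F x → Root x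
  small-k-root k≤2 x h = subst (+ m · pow 2 k ∣_) (ℤₚ.*-comm (F x) (+ 4))
    (∣-trans (*-monoˡ-∣ (pow 2 k) h) (*-monoʳ-∣ (F x) (pow-mono 2 k≤2)))

  root-or-condition-i : QuadraticResidue d n → (∃[ x ] Root x) ⊎ Condition-i a b d k m
  root-or-condition-i residue with k ℕₚ.≤? 2
  ... | yes k≤2 = [
      (λ (x , h) → inj₁ (x , small-k-root k≤2 x (⟂-cancel m⟂2 (∣2F x h))))
    , (λ obstacle → inj₂ (small-k k≤2 obstacle residue)) ]′
    (local-global (+ 2 · a) (+ 2 · b) (+ 2 · c) m 1≤m)
  ... | no k≰2 = [
      (λ (x , h) → inj₁ (x , large-root x (∣2F x h)))
    , (λ obstacle → inj₂ (large-k (ℕₚ.≰⇒> k≰2) obstacle residue)) ]′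
    (local-global (+ 2 · a) (+ 2 · b) (+ 2 · c) N 1≤N)
    where
    N = 2 ^ (k ∸ 1) * m
    1≤N : 1 ≤ N
    1≤N = ℕₚ.*-mono-≤ (ℕₚ.m^n>0 2 (k ∸ 1)) 1≤m
    large-root : ∀ x → + N ∣ + 2 · F x → Root x
    large-root x h = subst₂ _∣_ (2N≡ (ℕₚ.≰⇒> k≰2)) (sym (ℤₚ.*-assoc (+ 2) (+ 2) (F x))) (*-monoʳ-∣ (+ 2) h)

-- Sufficiency of (ii)-(iv)

∣-locally : ∀ z M → 1 ≤ M → (∀ p e → Prime p → pow p e ∣ + M → pow p e ∣ z) → + M ∣ z
∣-locally z = <-rec P step
  where
  P : ℕ → Set
  P M = 1 ≤ M → (∀ p e → Prime p → pow p e ∣ + M → pow p e ∣ z) → + M ∣ z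
  step : ∀ M → (∀ {N} → N < M → P N) → P M
  step M rec 1≤M local with 1 ℕₚ.<? M
  ... | no 1≮M = subst (λ N → + N ∣ z) (ℕₚ.≤-antisym 1≤M (ℕₚ.≮⇒≥ 1≮M)) (divides z (sym (ℤₚ.*-identityʳ z)))
  ... | yes 1<M with ∃-prime-factor M 1<M
  ...   | p , pp , p∣M with factor-power pp M {{ℕ.>-nonZero 1≤M}} p∣M
  ...     | e , M′ , 1≤e , M≡ , p∤M′ = subst (_∣ z) (sym M≡ℤ) (⟂-∣-· (⟂-sym (pow-⟂ pp p∤M′ e))
            (rec M′<M 1≤M′ λ q f qq h → local q f qq (∣-trans h (subst (+ M′ ∣_) (sym M≡ℤ) (∣m⇒∣m*n (pow p e) ∣-refl))))
            (local p e pp (divides (+ M′) M≡ℤ)))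
    where
    M≡ℤ : + M ≡ + M′ · pow p e
    M≡ℤ = trans (cong +_ M≡) (ℤₚ.pos-* M′ (p ^ e))
    1≤M′ : 1 ≤ M′
    1≤M′ = ℕₚ.n≢0⇒n>0 λ { refl → p∤M′ (divides (+ 0) refl) }
    M′<M : M′ < M
    M′<M = subst (M′ <_) (sym M≡) (ℕₚ.m<m*n M′ (p ^ e) {{ℕ.>-nonZero 1≤M′}}
      (ℕₚ.≤-<-trans 1≤e (n<p^n pp e)))

prime∣prime⇒≡ : ∀ {p q} → Prime p → Prime q → p ℕ∣.∣ q → p ≡ q
prime∣prime⇒≡ pp qq p∣q = [ (λ { refl → contradiction pp ¬prime[1] }) , (λ eq → eq) ]′ (prime⇒irreducible qq p∣q)

unique⇒squarefree : ∀ {p} ps → Prime p → All Prime ps → Unique ps → ¬ (p * p ℕ∣.∣ product ps)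
unique⇒squarefree {p} [] pp _ _ h = contradiction (subst Prime (ℕ∣.∣1⇒≡1 (ℕ∣.∣-trans (ℕ∣.m∣m*n p) h)) pp) ¬prime[1]
unique⇒squarefree {p} (q ∷ qs) pp (qq ∷ qqs) (q∉ ∷ uniq) h with p ℕₚ.≟ q
... | yes refl = All.lookup q∉ (factorisationHasAllPrimeFactors pp (ℕ∣.*-cancelˡ-∣ p {{prime⇒nonZero pp}} h) qqs) refl
... | no p≢q = unique⇒squarefree qs pp qqs uniq (square (cancel (ℕ∣.∣-trans (ℕ∣.m∣m*n p) h)) h)
  where
  cancel : ∀ {R} → p ℕ∣.∣ q * R → p ℕ∣.∣ R
  cancel {R} h = [ (λ p∣q → contradiction (prime∣prime⇒≡ pp qq p∣q) p≢q) , (λ h → h) ]′ (euclidsLemma q R pp h)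
  square : ∀ {R} → p ℕ∣.∣ R → p * p ℕ∣.∣ q * R → p * p ℕ∣.∣ R
  square (ℕ∣.divides R refl) h = ℕ∣.*-monoˡ-∣ p (cancel (ℕ∣.*-cancelʳ-∣ p {{prime⇒nonZero pp}}
    (subst (p * p ℕ∣.∣_) (sym (ℕₚ.*-assoc q R p)) h)))

EvenPrimePower : ℕ → ℕ × ℕ → Set
EvenPrimePower m (p , e) = Prime p × Oddℕ p × IsMultiplicity p e (+ m) × Evenℕ e

powers : List (ℕ × ℕ) → ℕ
powers pms = product (map (λ (p , e) → p ^ e) pms)

bases : List (ℕ × ℕ) → List ℕ
bases = map proj₁

select : ∀ {m p} pms → Prime p → p ℕ∣.∣ product (bases pms) → All (EvenPrimePower m) pms →
  ∃[ e ] EvenPrimePower m (p , e) × (p ^ e ℕ∣.∣ powers pms)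
select [] pp h _ = contradiction (subst Prime (ℕ∣.∣1⇒≡1 h) pp) ¬prime[1]
select {p = p} ((q , e) ∷ pms) pp h (good@(qq , _) ∷ goods) with euclidsLemma q (product (bases pms)) pp h
... | inj₂ h′ = let f , good′ , f∣ = select pms pp h′ goods in f , good′ , ℕ∣.∣n⇒∣m*n (q ^ e) f∣
... | inj₁ p∣q with prime∣prime⇒≡ pp qq p∣q
...   | refl = e , good , ℕ∣.m∣m*n (powers pms)

odd-form : ∀ y → ¬ (+ 2 ∣ y) → ∃[ q ] y ≡ + 1 + q · + 2
odd-form y 2∤y with y ℤ/.%ℕ 2 | y ℤ/./ℕ 2 | ℤ/.a≡a%ℕn+[a/ℕn]*n y 2 | ℤ/.n%ℕd<d y 2
... | 0 | q | y≡ | _ = contradiction (divides q (trans y≡ (ℤₚ.+-identityˡ _))) 2∤y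
... | 1 | q | y≡ | _ = q , y≡
... | suc (suc _) | _ | _ | s≤s (s≤s ())

odd+odd : ∀ {x y} → ¬ (+ 2 ∣ x) → ¬ (+ 2 ∣ y) → + 2 ∣ x + y
odd+odd {x} {y} 2∤x 2∤y = let s , x≡ = odd-form x 2∤x ; t , y≡ = odd-form y 2∤y in
  divides (s + t + + 1) (trans (cong₂ _+_ x≡ y≡) (identity s t))
  where
  identity : ∀ s t → + 1 + s · + 2 + (+ 1 + t · + 2) ≡ (s + t + + 1) · + 2
  identity = solve-∀

odd·odd : ∀ {x y} → ¬ (+ 2 ∣ x) → ¬ (+ 2 ∣ y) → ¬ (+ 2 ∣ x · y)
odd·odd {x} {y} 2∤x 2∤y h = [ 2∤x , 2∤y ]′ (euclid prime[2] x y h)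

2∣x[ax+b] : ∀ a b x → ¬ (+ 2 ∣ a) → ¬ (+ 2 ∣ b) → + 2 ∣ x · (a · x + b)
2∣x[ax+b] a b x 2∤a 2∤b with + 2 ∣? x
... | yes 2∣x = ∣m⇒∣m*n (a · x + b) 2∣x
... | no 2∤x = ∣n⇒∣m*n x (odd+odd (odd·odd 2∤a 2∤x) 2∤b)

8∣odd²-1 : ∀ y → ¬ (+ 2 ∣ y) → + 8 ∣ y · y - + 1
8∣odd²-1 y 2∤y = let q , y≡ = odd-form y 2∤y in
  subst (+ 8 ∣_) (sym (trans (cong (λ t → t · t - + 1) y≡) (identity q)))
    (*-monoʳ-∣ (+ 4) (2∣x[ax+b] (+ 1) (+ 1) q (prime∤1 prime[2]) (prime∤1 prime[2])))
  where
  identity : ∀ q → (+ 1 + q · + 2) · (+ 1 + q · + 2) - + 1 ≡ + 4 · (q · (+ 1 · q + + 1))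
  identity = solve-∀

2∤⇒Odd : ∀ {x} → ¬ (+ 2 ∣ + x) → Oddℕ x
2∤⇒Odd 2∤x h = 2∤x (∣ᵤ⇒∣ h)

Odd⇒2∤ : ∀ {x} → Oddℕ x → ¬ (+ 2 ∣ + x)
Odd⇒2∤ odd h = odd (∣⇒∣ᵤ h)

completed-square′ : ∀ a b c x →
  (+ 2 · a · x + b) · (+ 2 · a · x + b) ≡ + 4 · (a · (a · x · x + b · x + c)) + (b · b - + 4 · a · c)
completed-square′ = solve-∀

module Reduced {a n r k m} (R : Reduction a n r k m) (b′ c′ : ℤ) where
  open Reduction R

  b c : ℤ
  b = b′ · + r
  c = c′ · + r

  open Setting R b c public

  f : ℤ → ℤ
  f = quad a′ b′ c′

  ε : ℤ
  ε = b′ · b′ - + 4 · a′ · c′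

  F≡ : ∀ x → F x ≡ f x · + r
  F≡ x = trans (cong (λ t → t · x · x + b · x + c) a≡) (identity a′ b′ c′ x (+ r))
    where
    identity : ∀ a b c x r → a · r · x · x + b · r · x + c · r ≡ (a · x · x + b · x + c) · r
    identity = solve-∀

  d≡ : d ≡ ε · + (r ^ 2)
  d≡ = trans (cong (λ t → b · b - + 4 · t · c) a≡) (trans (identity a′ b′ c′ (+ r))
    (cong (ε ·_) (sym (trans (pow-suc r 1) (cong (+ r ·_) (pow-1 r))))))
    where
    identity : ∀ a b c r → b · r · (b · r) - + 4 · (a · r) · (c · r) ≡ (b · b - + 4 · a · c) · (r · r)
    identity = solve-∀

  ε-unique : ∀ {e} → d ≡ e · + (r ^ 2) → e ≡ ε
  ε-unique {e} eq = ℤₚ.*-cancelʳ-≡ e ε (+ (r ^ 2)) {{ℕₚ.m^n≢0 r 2 {{r≢0}}}} (trans (sym eq) d≡)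

  root-f : ∀ x → Root x → + m · pow 2 k ∣ + 4 · f x · + r
  root-f x h = subst (+ m · pow 2 k ∣_) (trans (cong (+ 4 ·_) (F≡ x)) (sym (ℤₚ.*-assoc (+ 4) (f x) (+ r)))) h

  f-root : ∀ x → + m · pow 2 k ∣ + 4 · f x → Root x
  f-root x h = subst (+ m · pow 2 k ∣_) (trans (ℤₚ.*-assoc (+ 4) (f x) (+ r)) (cong (+ 4 ·_) (sym (F≡ x)))) (∣m⇒∣m*n (+ r) h)

  n∣F⇒ : ∀ x → + n ∣ F x → + m · pow 2 k ∣ f x
  n∣F⇒ x h = *-cancelʳ-∣ (+ r) {+ m · pow 2 k} {f x} {{r≢0}} (subst₂ _∣_ n≡ (F≡ x) h)

  ⇒n∣F : ∀ x → + m · pow 2 k ∣ f x → + n ∣ F x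
  ⇒n∣F x h = subst₂ _∣_ (sym n≡) (sym (F≡ x)) (*-monoˡ-∣ (+ r) h)

  m⟂a′ : + m ⟂ a′
  m⟂a′ = ⟂-sym (⟂-∣ʳ a′⟂ (∣m⇒∣m*n (pow 2 k) ∣-refl))

  residue⇒m∣f : QuadraticResidue ε m → ∃[ x ] + m ∣ f x
  residue⇒m∣f (s , s²≈ε) = x , ⟂-cancel m⟂a′ (⟂-cancel m⟂4 m∣4a′f)
    where
    sol = ⟂-solve (⟂-sym (⟂-·ʳ m⟂2 m⟂a′)) (s - b′)
    x = proj₁ sol
    difference : ∀ t b s e → (t - (s - b)) · (t + b + s) + (s · s - e) ≡ (t + b) · (t + b) - e
    difference = solve-∀
    isolate : ∀ t e → t + e - e ≡ t
    isolate = solve-∀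
    m∣4a′f : + m ∣ + 4 · (a′ · f x)
    m∣4a′f = subst (+ m ∣_)
      (trans (difference (+ 2 · a′ · x) b′ s ε) (trans (cong (_- ε) (completed-square′ a′ b′ c′ x)) (isolate (+ 4 · (a′ · f x)) ε)))
      (∣m∣n⇒∣m+n (∣m⇒∣m*n (+ 2 · a′ · x + b′ + s) (proj₂ sol)) s²≈ε)

  residue⇒root : k ≤ 2 → QuadraticResidue ε m → ∃[ x ] Root x
  residue⇒root k≤2 residue = let x , h = residue⇒m∣f residue in
    x , f-root x (subst (+ m · pow 2 k ∣_) (ℤₚ.*-comm (f x) (+ 4))
      (∣-trans (*-monoˡ-∣ (pow 2 k) h) (*-monoʳ-∣ (f x) (pow-mono 2 k≤2))))

  r-m-f : ∀ x → Root x → + m ∣ f x · + r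
  r-m-f x h = subst (+ m ∣_) (F≡ x) (root⇒m∣ x h)

  -- A root only gives m ∣ f(x) r. Prime powers of m coprime to r cancel at once; for p ∣ δ one
  -- factor p is lost to r and has to be recovered.
  m∣f : ∀ {δ} → δ ≡ gcd m r → δ-Condition m δ ε → ∀ x → + m ∣ f x · + r → + m ∣ f x
  m∣f {δ} δ≡ δ-cond x m∣fr = ∣-locally (f x) m 1≤m local
    where
    1≤m : 1 ≤ m
    1≤m = ℕₚ.n≢0⇒n>0 λ { refl → 2∤m (divides (+ 0) refl) }
    module _ {p} (pp : Prime p) (p∣m : + p ∣ + m) (r₁ : ℤ) (r≡ : + r ≡ r₁ · + p) (p∤r₁ : ¬ (+ p ∣ r₁)) (odd : Oddℕ p) where
      -- After cancelling r, only p^(M-1) ∣ f(x) is known, M being 2(h + 1). Since p^M ∣ ε, the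
      -- square of z = 2a′x + b′ is divisible by p^(M-1); the exponent is odd, so p^(M/2) ∣ z and
      -- p^M ∣ z² = 4a′f(x) + ε.
      even-power : ∀ h → pow p (2 * suc h) ∣ + m → pow p (2 * suc h) ∣ ε → pow p (2 * suc h) ∣ f x
      even-power h M∣m M∣ε = ⟂-cancel (pow-⟂ pp p∤a′ M) (⟂-cancel (pow-⟂ pp p∤4 M)
        (∣m+n∣n⇒∣m (subst (pow p M ∣_) (completed-square′ a′ b′ c′ x) M∣z²) M∣ε))
        where
        M = 2 * suc h
        N = suc (2 * h)
        M≡ : M ≡ suc N
        M≡ = ℕₚ.*-suc 2 h
        z = + 2 · a′ · x + b′
        p∤a′ : ¬ (+ p ∣ a′)
        p∤a′ = ⟂⇒∤ pp (⟂-sym (⟂-∣ʳ (⟂-sym m⟂a′) p∣m))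
        p∤2 : ¬ (+ p ∣ + 2)
        p∤2 h = odd (ℕ∣.∣-reflexive (sym (∣2⇒≡2 pp h)))
        p∤4 : ¬ (+ p ∣ + 4)
        p∤4 h = [ p∤2 , p∤2 ]′ (euclid pp (+ 2) (+ 2) h)
        regroup : ∀ f r p → f · (r · p) ≡ p · (r · f)
        regroup = solve-∀
        N∣f : pow p N ∣ f x
        N∣f = ⟂-cancel (pow-⟂ pp p∤r₁ N) (pow-cancel pp 1 {N} {r₁ · f x}
          (subst₂ _∣_ (cong (pow p) M≡) (trans (cong (f x ·_) r≡) (trans (regroup (f x) r₁ (+ p)) (cong (_· (r₁ · f x)) (sym (pow-1 p)))))
            (∣-trans M∣m m∣fr)))
        N∣z² : pow p N ∣ z · z
        N∣z² = subst (pow p N ∣_) (sym (completed-square′ a′ b′ c′ x))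
          (∣m∣n⇒∣m+n (∣n⇒∣m*n (+ 4) (∣n⇒∣m*n a′ N∣f)) (∣-trans (pow-mono p (subst (N ≤_) (sym M≡) (ℕₚ.n≤1+n N))) M∣ε))
        h∣z : pow p (suc h) ∣ z
        h∣z = ∣square⇒∣ {K = N} {h = suc h} {s = z} pp (inj₂ (sym M≡)) N∣z²
        M∣z² : pow p M ∣ z · z
        M∣z² = subst (_∣ z · z) (sym (pow-double p (suc h))) (∣-trans (*-monoʳ-∣ (pow p (suc h)) h∣z) (*-monoˡ-∣ z h∣z))

    local : ∀ p e → Prime p → pow p e ∣ + m → pow p e ∣ f x
    local p zero pp _ = divides (f x) (sym (ℤₚ.*-identityʳ (f x)))
    local p (suc e) pp e∣m with + p ∣? + r
    ... | no p∤r = ⟂-cancel (pow-⟂ pp p∤r (suc e)) (subst (pow p (suc e) ∣_) (ℤₚ.*-comm (f x) (+ r)) (∣-trans e∣m m∣fr))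
    ... | yes p∣r = shared δ-cond
      where
      p∣m : + p ∣ + m
      p∣m = ∣-trans (∣pow p {suc e} (s≤s z≤n)) e∣m
      p∣δ : p ℕ∣.∣ δ
      p∣δ = subst (p ℕ∣.∣_) (sym δ≡) (gcd-greatest (∣⇒∣ᵤ p∣m) (∣⇒∣ᵤ p∣r))
      shared : δ-Condition m δ ε → pow p (suc e) ∣ f x
      shared (inj₁ δ≡1) = contradiction (subst Prime (ℕ∣.∣1⇒≡1 (subst (p ℕ∣.∣_) δ≡1 p∣δ)) pp) ¬prime[1]
      shared (inj₂ (pms , uniq , goods , δ≡product , powers∣ε)) = conclude (select pms pp p∣product goods′)
        where
        goods′ : All (EvenPrimePower m) pms
        goods′ = All.map (λ good → good) goods
        p∣product : p ℕ∣.∣ product (bases pms)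
        p∣product = subst (p ℕ∣.∣_) δ≡product p∣δ
        conclude : ∃[ M ] EvenPrimePower m (p , M) × (p ^ M ℕ∣.∣ powers pms) → pow p (suc e) ∣ f x
        conclude (_ , (_ , odd , (M∣m , M-max) , ℕ∣.divides zero refl) , _) = contradiction (M-max (suc e) e∣m) λ ()
        conclude (_ , (_ , odd , (M∣m , M-max) , ℕ∣.divides (suc h) refl) , M∣powers) =
          ∣-trans (pow-mono p (M-max (suc e) e∣m)) (subst (λ t → pow p t ∣ f x) (ℕₚ.*-comm 2 (suc h))
            (even-power pp p∣m (_∣_.quotient p∣r) (_∣_.equality p∣r) p∤r₁ odd h
              (subst (λ t → pow p t ∣ + m) (ℕₚ.*-comm (suc h) 2) M∣m)
              (subst (λ t → pow p t ∣ ε) (ℕₚ.*-comm (suc h) 2) (∣-trans (∣ᵤ⇒∣ M∣powers) powers∣ε))))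
          where
          p²∣m : + p · + p ∣ + m
          p²∣m = ∣-trans (subst (_∣ pow p (suc h * 2)) (trans (pow-suc p 1) (cong (+ p ·_) (pow-1 p)))
            (pow-mono p {2} {suc h * 2} (s≤s (s≤s z≤n)))) M∣m
          -- The multiplicity of p in m is even and positive, so p² ∣ m. If also p² ∣ r, then p²
          -- would divide δ, a product of distinct primes.
          p∤r₁ : ¬ (+ p ∣ _∣_.quotient p∣r)
          p∤r₁ h = unique⇒squarefree (bases pms) pp (map⁺ (All.map proj₁ goods′)) uniq
            (subst (p * p ℕ∣.∣_) (trans (sym δ≡) δ≡product) (gcd-greatest
              (∣⇒∣ᵤ (subst (_∣ + m) (sym (ℤₚ.pos-* p p)) p²∣m))
              (∣⇒∣ᵤ (subst₂ _∣_ (sym (ℤₚ.pos-* p p)) (sym (_∣_.equality p∣r)) (*-monoˡ-∣ (+ p) h)))))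

  condition-ii⇒ : ∀ {δ} → δ ≡ gcd m r → Condition-ii b c d r k m δ →
    (∃[ x ] Root x) × (∀ x → Root x → + n ∣ F x)
  condition-ii⇒ {δ} δ≡ (refl , _ , _ , e , d≡e , residue , δ-cond) =
      residue⇒root z≤n (subst (λ t → QuadraticResidue t m) (ε-unique d≡e) residue)
    , λ x h → ⇒n∣F x (subst (_∣ f x) (sym (ℤₚ.*-identityʳ (+ m)))
        (m∣f δ≡ (subst (δ-Condition m δ) (ε-unique d≡e) δ-cond) x (r-m-f x h)))

  condition-iii⇒ : ∀ {δ} → δ ≡ gcd m r → Condition-iii a b c d r k m δ →
    (∃[ x ] Root x) × (∀ x → Root x → + n ∣ F x)
  condition-iii⇒ {δ} δ≡ (refl , a″ , b″ , c″ , e , a≡″ , b≡″ , c≡″ , d≡e , b-odd , a-or-c-even , residue , δ-cond) =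
      residue⇒root (s≤s z≤n) (subst (λ t → QuadraticResidue t m) (ε-unique d≡e) residue)
    , λ x h → ⇒n∣F x (⟂-∣-· (⟂-sym (pow-⟂ prime[2] 2∤m 1))
        (m∣f δ≡ (subst (δ-Condition m δ) (ε-unique d≡e) δ-cond) x (r-m-f x h)) (2∣f x))
    where
    cancel-r : ∀ {u v} → u · + r ≡ v · + r → u ≡ v
    cancel-r {u} {v} = ℤₚ.*-cancelʳ-≡ u v (+ r) {{r≢0}}
    2∤a′ : ¬ (+ 2 ∣ a′)
    2∤a′ = ⟂⇒∤ prime[2] (⟂-sym (⟂-∣ʳ a′⟂ (∣n⇒∣m*n (+ m) ∣-refl)))
    2∤b′ : ¬ (+ 2 ∣ b′)
    2∤b′ = subst Oddℤ (sym (cancel-r b≡″)) b-odd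
    2∣c′ : + 2 ∣ c′
    2∣c′ = [ (λ h → contradiction (subst Evenℤ (sym (cancel-r (trans (sym a≡) a≡″))) h) 2∤a′)
           , subst Evenℤ (sym (cancel-r c≡″)) ]′ a-or-c-even
    split : ∀ a b c x → x · (a · x + b) + c ≡ a · x · x + b · x + c
    split = solve-∀
    2∣f : ∀ x → + 2 ∣ f x
    2∣f x = subst (+ 2 ∣_) (split a′ b′ c′ x) (∣m∣n⇒∣m+n (2∣x[ax+b] a′ b′ x 2∤a′ 2∤b′) 2∣c′)

  module TwoAdic {j f₀} (k≡ : k ≡ suc (2 * j)) (1≤j : 1 ≤ j) (ε≡ : ε ≡ f₀ · pow 2 (2 * j)) (f₀≈1 : + 8 ∣ f₀ - + 1) where

    J = pow 2 j

    k-pow : pow 2 k ≡ + 2 · (J · J)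
    k-pow = trans (cong (pow 2) k≡) (trans (pow-suc 2 (2 * j)) (cong (+ 2 ·_) (pow-double 2 j)))

    2∤a′ : ¬ (+ 2 ∣ a′)
    2∤a′ = ⟂⇒∤ prime[2] (⟂-sym (⟂-∣ʳ a′⟂ (∣n⇒∣m*n (+ m) (∣pow 2 (subst (1 ≤_) (sym k≡) (s≤s z≤n))))))

    2∣J : + 2 ∣ J
    2∣J = ∣pow 2 1≤j

    2∣ε : + 2 ∣ ε
    2∣ε = subst (+ 2 ∣_) (sym ε≡) (∣n⇒∣m*n f₀ (∣pow 2 (ℕₚ.≤-trans 1≤j (ℕₚ.m≤m+n j _))))

    2∣b′ : + 2 ∣ b′
    2∣b′ = [ (λ h → h) , (λ h → h) ]′ (euclid prime[2] b′ b′
      (∣m+n∣n⇒∣m 2∣ε (∣m⇒∣-m (∣m⇒∣m*n c′ (∣m⇒∣m*n a′ (divides (+ 2) refl))))))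

    2∣f₀-1 : + 2 ∣ f₀ - + 1
    2∣f₀-1 = ∣-trans (divides (+ 4) refl) f₀≈1

    -- An explicit square root of ε at 2: the difference is 4^j (1 - f₀), and 2^k = 2 · 4^j needs
    -- only one factor 2 from 1 - f₀.
    J²≈ε : pow 2 k ∣ J · J - ε
    J²≈ε = subst₂ _∣_ (sym k-pow) (trans (regroup f₀ (J · J)) (cong (λ t → J · J - t) (sym (trans ε≡ (cong (f₀ ·_) (pow-double 2 j))))))
      (∣m⇒∣-m (*-monoˡ-∣ (J · J) 2∣f₀-1))
      where
      regroup : ∀ g t → - ((g - + 1) · t) ≡ t - g · t
      regroup = solve-∀

    pow-k⟂a′ : pow 2 k ⟂ a′
    pow-k⟂a′ = ⟂-sym (⟂-∣ʳ a′⟂ (∣n⇒∣m*n (+ m) ∣-refl))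

    -- It suffices that 2a′x + b′ ≡ J modulo 2^k. As J and b′ are even, the equation can be halved,
    -- and then a′ is invertible.
    two-adic-root : ∃[ x ] pow 2 k ∣ + 4 · f x
    two-adic-root = x , ⟂-cancel pow-k⟂a′ (subst (pow 2 k ∣_) (value) z²≈ε)
      where
      b″ = _∣_.quotient 2∣b′
      J′ = _∣_.quotient 2∣J
      sol = ⟂-solve (⟂-sym pow-k⟂a′) (J′ - b″)
      x = proj₁ sol
      z = + 2 · a′ · x + b′
      regroup : ∀ a x s t → + 2 · (a · x - (s - t)) ≡ + 2 · a · x + t · + 2 - s · + 2
      regroup = solve-∀
      z≈J : pow 2 k ∣ z - J
      z≈J = subst (pow 2 k ∣_) (trans (regroup a′ x J′ b″)
        (cong₂ (λ s t → + 2 · a′ · x + s - t) (sym (_∣_.equality 2∣b′)) (sym (_∣_.equality 2∣J))))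
        (∣n⇒∣m*n (+ 2) (proj₂ sol))
      difference : ∀ z j e → (z - j) · (z + j) + (j · j - e) ≡ z · z - e
      difference = solve-∀
      z²≈ε : pow 2 k ∣ z · z - ε
      z²≈ε = subst (pow 2 k ∣_) (difference z J ε) (∣m∣n⇒∣m+n (∣m⇒∣m*n (z + J) z≈J) J²≈ε)
      isolate : ∀ a t e → + 4 · (a · t) + e - e ≡ a · (+ 4 · t)
      isolate = solve-∀
      value : z · z - ε ≡ a′ · (+ 4 · f x)
      value = trans (cong (_- ε) (completed-square′ a′ b′ c′ x)) (isolate a′ (f x) ε)

    root : QuadraticResidue ε m → ∃[ x ] Root x
    root residue = x , f-root x (⟂-∣-· m⟂pow (∣n⇒∣m*n (+ 4) (quad-cong a′ b′ c′ (proj₁ (proj₂ sol)) (proj₂ odd-root)))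
      (subst (pow 2 k ∣_) (scaled a′ b′ c′ x)
        (quad-cong (+ 4 · a′) (+ 4 · b′) (+ 4 · c′) (proj₂ (proj₂ sol))
          (subst (pow 2 k ∣_) (sym (scaled a′ b′ c′ (proj₁ two-adic-root))) (proj₂ two-adic-root)))))
      where
      m⟂pow : + m ⟂ pow 2 k
      m⟂pow = ⟂-sym (pow-⟂ prime[2] 2∤m k)
      odd-root = residue⇒m∣f residue
      sol = ⟂-crt m⟂pow (proj₁ odd-root) (proj₁ two-adic-root)
      x = proj₁ sol
      scaled : ∀ a b c x → + 4 · a · x · x + + 4 · b · x + + 4 · c ≡ + 4 · (a · x · x + b · x + c)
      scaled = solve-∀

    -- Both terms of z² = 4a′f(x) + ε are divisible by 4^j, so z = yJ and 4a′f(x) = 4^j (y² - f₀).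
    -- The hypothesis makes y² - f₀ even, hence y odd; then y² ≡ 1 ≡ f₀ modulo 8, and 4^j · 8 = 4 ·
    -- 2^k divides 4a′f(x).
    lift : ∀ x → pow 2 k ∣ + 4 · f x → pow 2 k ∣ f x
    lift x h = ⟂-cancel pow-k⟂a′ (*-cancelˡ-∣ (+ 4) {pow 2 k} {a′ · f x} 4k∣)
      where
      z = + 2 · a′ · x + b′
      commute : ∀ a t → + 4 · (a · t) ≡ a · (+ 4 · t)
      commute = solve-∀
      k∣4a′f : pow 2 k ∣ + 4 · (a′ · f x)
      k∣4a′f = subst (pow 2 k ∣_) (sym (commute a′ (f x))) (∣n⇒∣m*n a′ h)
      2j∣z² : pow 2 (2 * j) ∣ z · z
      2j∣z² = subst (pow 2 (2 * j) ∣_) (sym (completed-square′ a′ b′ c′ x))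
        (∣m∣n⇒∣m+n (∣-trans (pow-mono 2 (subst (2 * j ≤_) (sym k≡) (ℕₚ.n≤1+n _))) k∣4a′f)
          (subst (pow 2 (2 * j) ∣_) (sym ε≡) (∣n⇒∣m*n f₀ ∣-refl)))
      J∣z : J ∣ z
      J∣z = ∣square⇒∣ {K = 2 * j} {h = j} {s = z} prime[2] (inj₁ refl) 2j∣z²
      y = _∣_.quotient J∣z
      z≡ : z ≡ y · J
      z≡ = _∣_.equality J∣z
      isolate : ∀ t e → t ≡ t + e - e
      isolate = solve-∀
      factor : ∀ y J g → y · J · (y · J) - g · (J · J) ≡ J · J · (y · y - g)
      factor = solve-∀
      4a′f≡ : + 4 · (a′ · f x) ≡ J · J · (y · y - f₀)
      4a′f≡ = trans (isolate (+ 4 · (a′ · f x)) ε) (trans (cong (_- ε) (sym (completed-square′ a′ b′ c′ x)))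
        (trans (cong₂ _-_ (cong (λ t → t · t) z≡) (trans ε≡ (cong (f₀ ·_) (pow-double 2 j)))) (factor y J f₀)))
      2∣y²-f₀ : + 2 ∣ y · y - f₀
      2∣y²-f₀ = subst (_∣ y · y - f₀) (pow-1 2) (pow-cancel prime[2] (2 * j) {1} {y · y - f₀}
        (subst₂ _∣_ (cong (pow 2) (trans k≡ (ℕₚ.+-comm 1 (2 * j))))
          (trans 4a′f≡ (cong (_· (y · y - f₀)) (sym (pow-double 2 j)))) k∣4a′f))
      y-odd : ¬ (+ 2 ∣ y)
      y-odd 2∣y = prime∤1 prime[2] (subst (+ 2 ∣_) (identity y f₀)
        (∣m∣n⇒∣m-n (∣m∣n⇒∣m-n (∣m⇒∣m*n y 2∣y) 2∣y²-f₀) 2∣f₀-1))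
        where
        identity : ∀ y g → y · y - (y · y - g) - (g - + 1) ≡ + 1
        identity = solve-∀
      8∣y²-f₀ : + 8 ∣ y · y - f₀
      8∣y²-f₀ = subst (+ 8 ∣_) (identity y f₀) (∣m∣n⇒∣m-n (8∣odd²-1 y y-odd) f₀≈1)
        where
        identity : ∀ y g → y · y - + 1 - (g - + 1) ≡ y · y - g
        identity = solve-∀
      regroup : ∀ t → t · + 8 ≡ + 4 · (+ 2 · t)
      regroup = solve-∀
      4k∣ : + 4 · pow 2 k ∣ + 4 · (a′ · f x)
      4k∣ = subst₂ _∣_ (trans (regroup (J · J)) (cong (+ 4 ·_) (sym k-pow))) (sym 4a′f≡) (*-monoʳ-∣ (J · J) 8∣y²-f₀)

  condition-iv⇒ : ∀ {δ} → δ ≡ gcd m r → Condition-iv b c d r k m δ →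
    (∃[ x ] Root x) × (∀ x → Root x → + n ∣ F x)
  condition-iv⇒ {δ} δ≡ (3≤k , r-odd , k-odd , _ , _ , e , f₀ , d≡e , _ , d≡f₀ , f₀≈1 , residue , δ-cond) = split (parity k)
    where
    regroup : ∀ f s t → f · (s · t) ≡ f · t · s
    regroup = solve-∀
    ε≡ : f₀ · pow 2 (k ∸ 1) ≡ ε
    ε≡ = ε-unique (trans d≡f₀ (trans (cong (f₀ ·_) (ℤₚ.pos-* (r ^ 2) (2 ^ (k ∸ 1)))) (regroup f₀ (+ (r ^ 2)) (pow 2 (k ∸ 1)))))
    split : ∃[ h ] (k ≡ 2 * h ⊎ suc k ≡ 2 * h) → (∃[ x ] Root x) × (∀ x → Root x → + n ∣ F x)
    split (h , inj₁ eq) = contradiction (ℕ∣.divides h (trans eq (ℕₚ.*-comm 2 h))) k-odd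
    split (suc j , inj₂ eq) = root (subst (λ t → QuadraticResidue t m) (ε-unique d≡e) residue) ,
      λ x h → ⇒n∣F x (⟂-∣-· (⟂-sym (pow-⟂ prime[2] 2∤m k))
        (m∣f δ≡ (subst (δ-Condition m δ) (ε-unique d≡e) δ-cond) x (r-m-f x h))
        (lift x (⟂-cancel (pow-⟂ prime[2] (Odd⇒2∤ r-odd) k)
          (subst (pow 2 k ∣_) (ℤₚ.*-comm (+ 4 · f x) (+ r)) (∣-trans (∣n⇒∣m*n (+ m) ∣-refl) (root-f x h))))))
      where
      k≡ : k ≡ suc (2 * j)
      k≡ = ℕₚ.suc-injective (trans eq (ℕₚ.*-suc 2 j))
      1≤j : 1 ≤ j
      1≤j = ℕₚ.n≢0⇒n>0 λ { refl → ℕₚ.<⇒≱ (s≤s (s≤s z≤n)) (subst (3 ≤_) k≡ 3≤k) }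
      open TwoAdic {j} {f₀} k≡ 1≤j (trans (sym ε≡) (cong (λ t → f₀ · pow 2 (t ∸ 1)) k≡)) f₀≈1

-- Necessity of (ii)-(iv)

prime∣^ : ∀ {p} q e → Prime p → p ℕ∣.∣ q ^ e → p ℕ∣.∣ q
prime∣^ q zero pp h = contradiction (subst Prime (ℕ∣.∣1⇒≡1 h) pp) ¬prime[1]
prime∣^ q (suc e) pp h = [ (λ h → h) , prime∣^ q e pp ]′ (euclidsLemma q (q ^ e) pp h)

prime∣powers : ∀ {m p} pms → Prime p → All (EvenPrimePower m) pms → p ℕ∣.∣ powers pms → p ∈ bases pms
prime∣powers [] pp _ h = contradiction (subst Prime (ℕ∣.∣1⇒≡1 h) pp) ¬prime[1]
prime∣powers ((q , e) ∷ pms) pp ((qq , _) ∷ goods) h with euclidsLemma (q ^ e) (powers pms) pp h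
... | inj₁ h′ = here (prime∣prime⇒≡ pp qq (prime∣^ q e pp h′))
... | inj₂ h′ = there (prime∣powers pms pp goods h′)

-- This is gcd(2^k, 4). A root amounts to `stride k ∣ F x`, so `gap k` is the part of m · 2^k that
-- comes only with validity. The truncated `k ∸ 2` in `stride` is intended: for k ≤ 2 the stride is
-- m.
gap : ℕ → ℤ
gap 0 = + 1
gap 1 = + 2
gap (suc (suc _)) = + 4

quad-shift : ∀ a b c x t → (a · (x + t) · (x + t) + b · (x + t) + c) - (a · x · x + b · x + c) ≡ t · (a · (+ 2 · x + t) + b)
quad-shift = solve-∀

module _ {m : ℕ} (2∤m : ¬ (+ 2 ∣ + m)) where

  stride : ℕ → ℤ
  stride k = + m · pow 2 (k ∸ 2)

  stride·gap : ∀ k → stride k · gap k ≡ + m · pow 2 k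
  stride·gap 0 = ℤₚ.*-identityʳ _
  stride·gap 1 = cong (_· + 2) (ℤₚ.*-identityʳ (+ m))
  stride·gap (suc (suc k)) = trans (regroup (+ m) (pow 2 k))
    (cong (+ m ·_) (sym (trans (pow-suc 2 (suc k)) (cong (+ 2 ·_) (pow-suc 2 k)))))
    where
    regroup : ∀ m t → m · t · + 4 ≡ m · (+ 2 · (+ 2 · t))
    regroup = solve-∀

  gap∣4 : ∀ k → gap k ∣ + 4
  gap∣4 0 = divides (+ 4) refl
  gap∣4 1 = divides (+ 2) refl
  gap∣4 (suc (suc _)) = divides (+ 1) refl

  stride∣⇒ : ∀ k y → stride k ∣ y → + m · pow 2 k ∣ + 4 · y
  stride∣⇒ k y h = subst₂ _∣_ (stride·gap k) (ℤₚ.*-comm y (+ 4))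
    (∣-trans (*-monoˡ-∣ (gap k) h) (*-monoʳ-∣ y (gap∣4 k)))

  ⇒stride∣ : ∀ k y → + m · pow 2 k ∣ + 4 · y → stride k ∣ y
  ⇒stride∣ 0 y h = subst (_∣ y) (sym (ℤₚ.*-identityʳ (+ m))) (⟂-cancel (⟂-·ʳ (2-⟂ 2∤m) (2-⟂ 2∤m))
    (subst (_∣ + 4 · y) (ℤₚ.*-identityʳ (+ m)) h))
  ⇒stride∣ 1 y h = subst (_∣ y) (sym (ℤₚ.*-identityʳ (+ m))) (⟂-cancel (⟂-·ʳ (2-⟂ 2∤m) (2-⟂ 2∤m))
    (∣-trans (∣m⇒∣m*n (pow 2 1) ∣-refl) h))
  ⇒stride∣ k@(suc (suc j)) y h = *-cancelˡ-∣ (+ 4) {stride k} {y}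
    (subst (_∣ + 4 · y) (trans (sym (stride·gap k)) (ℤₚ.*-comm (stride k) (+ 4))) h)

  stride-nonZero : ∀ k → ℤ.NonZero (stride k)
  stride-nonZero k = ℤₚ.i*j≢0 (+ m) (pow 2 (k ∸ 2)) {{ℕ.≢-nonZero λ { refl → 2∤m (divides (+ 0) refl) }}} {{pow-nonZero prime[2] (k ∸ 2)}}

module _ {a n r k m} (R : Reduction a n r k m) (b c : ℤ) where
  open Reduction R
  open Setting R b c

  module _ (x : ℤ) (x-root : Root x) (H : ∀ x → Root x → + n ∣ F x) where

    private
      N = stride 2∤m k

    r∣n : + r ∣ + n
    r∣n = subst (+ r ∣_) (sym n≡) (∣n⇒∣m*n (+ m · pow 2 k) ∣-refl)

    r∣a : + r ∣ a
    r∣a = divides a′ a≡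

    shifted-root : Root (x + N)
    shifted-root = stride∣⇒ 2∤m k (F (x + N)) (∣m+n∣n⇒∣m {N} {F (x + N)} { - F x}
      (subst (N ∣_) (sym (quad-shift a b c x N)) (∣m⇒∣m*n (a · (+ 2 · x + N) + b) ∣-refl))
      (∣m⇒∣-m (⇒stride∣ 2∤m k (F x) x-root)))

    -- The values at x and x + N differ by N(a(2x + N) + b), while n = N · `gap k` · r divides both.
    -- Cancelling N leaves r ∣ a(2x + N) + b, and r ∣ a.
    valid⇒r∣b : + r ∣ b
    valid⇒r∣b = ∣m+n∣m⇒∣n (∣-trans (∣n⇒∣m*n (gap k) ∣-refl)
        (*-cancelˡ-∣ N {gap k · + r} {a · (+ 2 · x + N) + b} {{stride-nonZero 2∤m k}}
          (subst₂ _∣_ (trans n≡ (trans (cong (_· + r) (sym (stride·gap 2∤m k))) (ℤₚ.*-assoc N (gap k) (+ r))))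
            (quad-shift a b c x N) (∣m∣n⇒∣m-n (H (x + N) shifted-root) (H x x-root)))))
      (∣m⇒∣m*n (+ 2 · x + N) r∣a)

    valid⇒r∣c : + r ∣ c
    valid⇒r∣c = ∣m+n∣m⇒∣n (∣-trans r∣n (H x x-root))
      (∣m∣n⇒∣m+n (∣m⇒∣m*n x (∣m⇒∣m*n x r∣a)) (∣m⇒∣m*n x valid⇒r∣b))

module Necessity {a n r k m} (R : Reduction a n r k m) (b′ c′ : ℤ) (x₀ : ℤ)
  (x₀-root : Reduced.Root R b′ c′ x₀)
  (H : ∀ x → Reduced.Root R b′ c′ x → + n ∣ Reduced.F R b′ c′ x) where
  open Reduction R
  open Reduced R b′ c′

  N = stride 2∤m k
  z₀ = + 2 · a′ · x₀ + b′

  mk∣f : ∀ x → Root x → + m · pow 2 k ∣ f x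
  mk∣f x h = n∣F⇒ x (H x h)

  m∣f₀ : + m ∣ f x₀
  m∣f₀ = ∣-trans (∣m⇒∣m*n (pow 2 k) ∣-refl) (mk∣f x₀ x₀-root)

  residue : QuadraticResidue ε m
  residue = z₀ , subst (+ m ∣_) (sym (trans (cong (_- ε) (completed-square′ a′ b′ c′ x₀)) (isolate (+ 4 · (a′ · f x₀)) ε)))
    (∣n⇒∣m*n (+ 4) (∣n⇒∣m*n a′ m∣f₀))
    where
    isolate : ∀ t e → t + e - e ≡ t
    isolate = solve-∀

  translate-root : ∀ t → N ∣ t → Root (x₀ + t)
  translate-root t N∣t = f-root (x₀ + t) (stride∣⇒ 2∤m k (f (x₀ + t)) (∣m+n∣n⇒∣m {N} {f (x₀ + t)} { - f x₀}
    (subst (N ∣_) (sym (quad-shift a′ b′ c′ x₀ t)) (∣m⇒∣m*n (a′ · (+ 2 · x₀ + t) + b′) N∣t))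
    (∣m⇒∣-m (∣-trans (subst (N ∣_) (stride·gap 2∤m k) (∣m⇒∣m*n (gap k) ∣-refl)) (mk∣f x₀ x₀-root)))))

  gap∣ : ∀ t u → t ≡ u · N → gap k ∣ u · (a′ · (+ 2 · x₀ + t) + b′)
  gap∣ t u refl = *-cancelˡ-∣ N {gap k} {u · (a′ · (+ 2 · x₀ + t) + b′)} {{stride-nonZero 2∤m k}}
    (subst₂ _∣_ (sym (stride·gap 2∤m k)) (trans (quad-shift a′ b′ c′ x₀ t) (regroup u N _))
      (∣m∣n⇒∣m-n (mk∣f (x₀ + t) (translate-root t (divides u refl))) (mk∣f x₀ x₀-root)))
    where
    regroup : ∀ u N s → u · N · s ≡ N · (u · s)
    regroup = solve-∀

  gap∣+ : gap k ∣ a′ · (+ 2 · x₀ + N) + b′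
  gap∣+ = subst (λ t → gap k ∣ a′ · (+ 2 · x₀ + t) + b′) (ℤₚ.*-identityˡ N)
    (subst (gap k ∣_) (ℤₚ.*-identityˡ _) (gap∣ (+ 1 · N) (+ 1) refl))

  gap∣- : gap k ∣ - (a′ · (+ 2 · x₀ - N) + b′)
  gap∣- = subst (gap k ∣_) (identity a′ b′ x₀ N) (gap∣ (- + 1 · N) (- + 1) refl)
    where
    identity : ∀ a b x N → - + 1 · (a · (+ 2 · x + - + 1 · N) + b) ≡ - (a · (+ 2 · x - N) + b)
    identity = solve-∀

  k≥1⇒2∤a′ : 1 ≤ k → ¬ (+ 2 ∣ a′)
  k≥1⇒2∤a′ 1≤k = ⟂⇒∤ prime[2] (⟂-sym (⟂-∣ʳ a′⟂ (∣n⇒∣m*n (+ m) (∣pow 2 1≤k))))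

  -- With gap 4 and stride m, comparing the shifts by m and by -m gives 4 ∣ 2a′m, although a′ and m
  -- are odd.
  k≡2⇒⊥ : ¬ (k ≡ 2)
  k≡2⇒⊥ refl = [ (λ h → k≥1⇒2∤a′ (s≤s z≤n) h) , 2∤m ]′ (euclid prime[2] a′ (+ m)
    (*-cancelˡ-∣ (+ 2) {+ 2} {a′ · + m} (subst (+ 4 ∣_) (identity a′ b′ x₀ (+ m)) (∣m∣n⇒∣m+n gap∣+ gap∣-))))
    where
    identity : ∀ a b x m → a · (+ 2 · x + m · + 1) + b + - (a · (+ 2 · x - m · + 1) + b) ≡ + 2 · (a · m)
    identity = solve-∀

  k≡1⇒2∤b′ : k ≡ 1 → ¬ (+ 2 ∣ b′)
  k≡1⇒2∤b′ refl 2∣b′ = [ k≥1⇒2∤a′ (s≤s z≤n) , 2∤m ]′ (euclid prime[2] a′ (+ m)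
    (subst (+ 2 ∣_) (identity a′ b′ x₀ (+ m)) (∣m∣n⇒∣m-n (∣m∣n⇒∣m-n gap∣+ 2∣b′) (∣m⇒∣m*n (a′ · x₀) ∣-refl))))
    where
    identity : ∀ a b x m → a · (+ 2 · x + m · + 1) + b - b - + 2 · (a · x) ≡ a · m
    identity = solve-∀

  k≡1⇒2∣c′ : k ≡ 1 → + 2 ∣ c′
  k≡1⇒2∣c′ refl = subst (+ 2 ∣_) (identity a′ b′ c′ x₀) (∣m∣n⇒∣m-n
    (∣-trans (∣n⇒∣m*n (+ m) ∣-refl) (mk∣f x₀ x₀-root))
    (2∣x[ax+b] a′ b′ x₀ (k≥1⇒2∤a′ (s≤s z≤n)) (k≡1⇒2∤b′ refl)))
    where
    identity : ∀ a b c x → a · x · x + b · x + c - x · (a · x + b) ≡ c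
    identity = solve-∀

  k≥3⇒2∣b′ : 3 ≤ k → + 2 ∣ b′
  k≥3⇒2∣b′ 3≤k = subst (+ 2 ∣_) (identity a′ b′ x₀ N) (∣m∣n⇒∣m-n (∣m∣n⇒∣m-n (∣-trans (2∣gap 3≤k) gap∣+)
      (∣n⇒∣m*n a′ 2∣N)) (∣m⇒∣m*n (a′ · x₀) ∣-refl))
    where
    2∣gap : ∀ {k} → 3 ≤ k → + 2 ∣ gap k
    2∣gap (s≤s (s≤s _)) = divides (+ 2) refl
    2∣N : + 2 ∣ N
    2∣N = ∣n⇒∣m*n (+ m) (∣pow 2 (ℕₚ.m<n⇒0<n∸m 3≤k))
    identity : ∀ a b x N → a · (+ 2 · x + N) + b - a · N - + 2 · (a · x) ≡ b
    identity = solve-∀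

  module _ (s : ℤ) (t : ℤ) where

    along-line : f (x₀ + s · t) ≡ trans-quad (a′ · s · s) (s · z₀) t + f x₀
    along-line = identity a′ b′ c′ x₀ s t
      where
      identity : ∀ a b c x s t → a · (x + s · t) · (x + s · t) + b · (x + s · t) + c
        ≡ t · (a · s · s · t + s · (+ 2 · a · x + b)) + (a · x · x + b · x + c)
      identity = solve-∀

    s∣trans-quad : s ∣ trans-quad (a′ · s · s) (s · z₀) t
    s∣trans-quad = divides (t · (a′ · s · t + z₀)) (identity a′ s t z₀)
      where
      identity : ∀ a s t z → t · (a · s · s · t + s · z) ≡ t · (a · s · t + z) · s
      identity = solve-∀

  -- Isolates one prime: S is its power in the stride and s carries the rest. Steps by multiples of
  -- s preserve divisibility by s, so whether x₀ + st is a root is decided by S alone. The factor r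
  -- is there because a root concerns F = f · r, whereas the conclusion concerns f.
  line-lift : ∀ S s t {M} → S ⟂ s → stride 2∤m k ∣ S · s → S ∣ f x₀ → s ∣ f x₀ → M ∣ f x₀ → M ∣ + m · pow 2 k →
    S ∣ + r · trans-quad (a′ · s · s) (s · z₀) t → M ∣ trans-quad (a′ · s · s) (s · z₀) t
  line-lift S s t {M} S⟂s N∣Ss S∣f₀ s∣f₀ M∣f₀ M∣mk h =
    ∣m+n∣n⇒∣m (subst (M ∣_) (along-line s t) (∣-trans M∣mk (mk∣f x x-root))) M∣f₀
    where
    x = x₀ + s · t
    Q = trans-quad (a′ · s · s) (s · z₀) t
    S∣rf : S ∣ + r · f x
    S∣rf = subst (λ w → S ∣ + r · w) (sym (along-line s t)) (subst (S ∣_) (sym (ℤₚ.*-distribˡ-+ (+ r) Q (f x₀)))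
      (∣m∣n⇒∣m+n h (∣n⇒∣m*n (+ r) S∣f₀)))
    s∣rf : s ∣ + r · f x
    s∣rf = ∣n⇒∣m*n (+ r) (subst (s ∣_) (sym (along-line s t)) (∣m∣n⇒∣m+n (s∣trans-quad s t) s∣f₀))
    x-root : Root x
    x-root = stride∣⇒ 2∤m k (F x) (subst (N ∣_) (trans (ℤₚ.*-comm (+ r) (f x)) (sym (F≡ x)))
      (∣-trans N∣Ss (⟂-∣-· S⟂s S∣rf s∣rf)))

  K≡ : 3 ≤ k → k ≡ suc (suc (k ∸ 2))
  K≡ (s≤s (s≤s _)) = refl

  module Dyadic (3≤k : 3 ≤ k) where

    b″ = _∣_.quotient (k≥3⇒2∣b′ 3≤k)
    -- Half of m · z₀, an integer because b′ is even; `two-lift` expects the linear coefficient in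
    -- doubled form.
    β = + m · (a′ · x₀ + b″)

    2β≡ : + m · z₀ ≡ + 2 · β
    2β≡ = trans (cong (λ t → + m · (+ 2 · a′ · x₀ + t)) (_∣_.equality (k≥3⇒2∣b′ 3≤k))) (identity (+ m) a′ x₀ b″)
      where
      identity : ∀ m a x t → m · (+ 2 · a · x + t · + 2) ≡ + 2 · (m · (a · x + t))
      identity = solve-∀

    1≤k : 1 ≤ k
    1≤k = ℕₚ.≤-trans (s≤s z≤n) 3≤k

    K = k ∸ 2

    pow-k∣f₀ : pow 2 k ∣ f x₀
    pow-k∣f₀ = ∣-trans (∣n⇒∣m*n (+ m) ∣-refl) (mk∣f x₀ x₀-root)

    hypothesis : ∀ t → pow 2 K ∣ + r · trans-quad (a′ · + m · + m) (+ 2 · β) t →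
      pow 2 (suc (suc K)) ∣ trans-quad (a′ · + m · + m) (+ 2 · β) t
    hypothesis t h = subst₂ (λ M w → pow 2 M ∣ trans-quad (a′ · + m · + m) w t) (K≡ 3≤k) 2β≡
      (line-lift (pow 2 K) (+ m) t (pow-⟂ prime[2] 2∤m K) (∣-reflexive (ℤₚ.*-comm (+ m) (pow 2 K)))
        (∣-trans (pow-mono 2 (ℕₚ.m∸n≤m k 2)) pow-k∣f₀) m∣f₀ pow-k∣f₀ (∣n⇒∣m*n (+ m) ∣-refl)
        (subst (λ w → pow 2 K ∣ + r · trans-quad (a′ · + m · + m) w t) (sym 2β≡) h))

    lifted = two-lift {a′ · + m · + m} {β} {+ r} {K} (odd·odd {a′ · + m} {+ m} (odd·odd {a′} {+ m} (k≥1⇒2∤a′ 1≤k) 2∤m) 2∤m) hypothesis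
    w = proj₁ lifted
    u = proj₁ (proj₂ lifted)

    K≡2w+1 : K ≡ suc (2 * w)
    K≡2w+1 = proj₁ (proj₂ (proj₂ lifted))

    β≡ : β ≡ u · pow 2 w
    β≡ = proj₁ (proj₂ (proj₂ (proj₂ lifted)))

    2∤u : ¬ (+ 2 ∣ u)
    2∤u = proj₁ (proj₂ (proj₂ (proj₂ (proj₂ lifted))))

    2∤r : ¬ (+ 2 ∣ + r)
    2∤r = proj₂ (proj₂ (proj₂ (proj₂ (proj₂ lifted))))

    k-odd : Oddℕ k
    k-odd 2∣k = prime∤1 prime[2] (∣m+n∣n⇒∣m (∣ᵤ⇒∣ {+ 2} {+ (1 ℕ.+ 2 * w)} (ℕ∣.∣m+n∣m⇒∣n {2} {2} (subst (2 ℕ∣.∣_) (trans (K≡ 3≤k) (cong (2 ℕ.+_) K≡2w+1)) 2∣k) ℕ∣.∣-refl))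
      (∣ᵤ⇒∣ {+ 2} {+ (2 * w)} (ℕ∣.m∣m*n w)))

    W² = pow 2 (2 * w)

    k-pow : pow 2 k ≡ + 8 · W²
    k-pow = trans (cong (pow 2) (trans (K≡ 3≤k) (cong (2 ℕ.+_) K≡2w+1))) (pow-+ 2 3 (2 * w))

    k∸1≡ : k ∸ 1 ≡ 2 ℕ.+ 2 * w
    k∸1≡ = trans (cong (_∸ 1) (K≡ 3≤k)) (cong suc K≡2w+1)

    k∸1-pow : pow 2 (k ∸ 1) ≡ + 4 · W²
    k∸1-pow = trans (cong (pow 2) k∸1≡) (pow-+ 2 2 (2 * w))

    φ = _∣_.quotient pow-k∣f₀

    -- m² ε = (2 β)² - 4 a′ m² f(x₀), where 2^k divides f(x₀).
    m²ε≡ : + m · + m · ε ≡ (u · u - + 8 · (a′ · (+ m · + m) · φ)) · pow 2 (k ∸ 1)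
    m²ε≡ = trans (completed (+ m) a′ b′ c′ x₀)
      (trans (cong₂ (λ s t → s · s - + 4 · a′ · (+ m · + m) · t) (trans 2β≡ (cong (+ 2 ·_) β≡)) (trans (_∣_.equality pow-k∣f₀) (cong (φ ·_) k-pow)))
        (trans (cong (λ t → + 2 · (u · P) · (+ 2 · (u · P)) - + 4 · a′ · (+ m · + m) · (φ · (+ 8 · t))) (pow-double 2 w))
          (trans (identity u P a′ (+ m) φ)
            (cong ((u · u - + 8 · (a′ · (+ m · + m) · φ)) ·_) (sym (trans k∸1-pow (cong (+ 4 ·_) (pow-double 2 w))))))))
      where
      P = pow 2 w
      completed : ∀ m a b c x → m · m · (b · b - + 4 · a · c)
        ≡ m · (+ 2 · a · x + b) · (m · (+ 2 · a · x + b)) - + 4 · a · (m · m) · (a · x · x + b · x + c)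
      completed = solve-∀
      identity : ∀ u P a m φ → + 2 · (u · P) · (+ 2 · (u · P)) - + 4 · a · (m · m) · (φ · (+ 8 · (P · P)))
        ≡ (u · u - + 8 · (a · (m · m) · φ)) · (+ 4 · (P · P))
      identity = solve-∀

    pow∣ε : pow 2 (k ∸ 1) ∣ ε
    pow∣ε = ⟂-cancel (pow-⟂ prime[2] (odd·odd {+ m} {+ m} 2∤m 2∤m) (k ∸ 1)) (divides (u · u - + 8 · (a′ · (+ m · + m) · φ)) m²ε≡)

    f₀ = _∣_.quotient pow∣ε

    ε≡ : ε ≡ f₀ · pow 2 (k ∸ 1)
    ε≡ = _∣_.equality pow∣ε

    m²f₀≡ : + m · + m · f₀ ≡ u · u - + 8 · (a′ · (+ m · + m) · φ)
    m²f₀≡ = ℤₚ.*-cancelʳ-≡ _ _ (pow 2 (k ∸ 1)) {{pow-nonZero prime[2] (k ∸ 1)}}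
      (trans (ℤₚ.*-assoc (+ m · + m) f₀ (pow 2 (k ∸ 1))) (trans (cong (+ m · + m ·_) (sym ε≡)) m²ε≡))

    -- Modulo 8, m² f₀ ≡ u², and the squares of the odd numbers m and u are both 1.
    f₀≈1 : + 8 ∣ f₀ - + 1
    f₀≈1 = subst (+ 8 ∣_) (rearrange (+ m · + m) (u · u) (a′ · (+ m · + m) · φ) f₀ m²f₀≡)
      (∣m∣n⇒∣m-n (∣m∣n⇒∣m-n (8∣odd²-1 u 2∤u) (∣m⇒∣m*n f₀ (8∣odd²-1 (+ m) 2∤m)))
        (∣m⇒∣m*n (a′ · (+ m · + m) · φ) ∣-refl))
      where
      rearrange : ∀ M U e g → M · g ≡ U - + 8 · e → U - + 1 - (M - + 1) · g - + 8 · e ≡ g - + 1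
      rearrange M U e g eq = trans (identity M U e g)
        (trans (cong (λ t → U - + 8 · e - t + (g - + 1)) eq) (cancel (U - + 8 · e) (g - + 1)))
        where
        identity : ∀ M U e g → U - + 1 - (M - + 1) · g - + 8 · e ≡ U - + 8 · e - M · g + (g - + 1)
        identity = solve-∀
        cancel : ∀ s t → s - s + t ≡ t
        cancel = solve-∀

    f₀-odd : ¬ (+ 2 ∣ f₀)
    f₀-odd h = prime∤1 prime[2] (∣m+n∣m⇒∣n {+ 2} {f₀ - + 1} {+ 1} (subst (+ 2 ∣_) (identity f₀) h) (∣-trans {+ 2} {+ 8} (divides (+ 4) refl) f₀≈1))
      where
      identity : ∀ g → g ≡ g - + 1 + + 1
      identity = solve-∀

    ε-mult : IsMultiplicity 2 (k ∸ 1) ε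
    ε-mult = cofactor⇒multiplicity prime[2] f₀-odd ε≡

  module _ {p} (pp : Prime p) (p∣m : + p ∣ + m) (p∣r : + p ∣ + r) where

    -- `odd-prime-lift` is applied along x₀ + st, where the stride is split into the full power S of
    -- p and the cofactor s. It yields S ∣ (s z₀)², hence S ∣ z₀², and ε = z₀² - 4a′f(x₀) with S ∣
    -- f(x₀).
    odd-prime-power : ∀ M m₁ → m ≡ m₁ * p ^ suc M → ¬ (+ p ∣ + m₁) →
      Evenℕ (suc M) × ¬ (+ p · + p ∣ + r) × pow p (suc M) ∣ ε
    odd-prime-power M m₁ m≡ p∤m₁ = even , p²∤r , subst (S ∣_) (isolate (z₀ · z₀) ε (+ 4 · (a′ · f x₀)) (completed-square′ a′ b′ c′ x₀))
        (∣m∣n⇒∣m-n S∣z₀² (∣n⇒∣m*n (+ 4) (∣n⇒∣m*n a′ S∣f₀)))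
      where
      S = pow p (suc M)
      s = + m₁ · pow 2 (k ∸ 2)
      p∤2 : ¬ (+ p ∣ + 2)
      p∤2 h = 2∤m (subst (λ t → + t ∣ + m) (∣2⇒≡2 pp h) p∣m)
      p∤a′ : ¬ (+ p ∣ a′)
      p∤a′ = ⟂⇒∤ pp (⟂-sym (⟂-∣ʳ (⟂-sym m⟂a′) p∣m))
      p∤s : ¬ (+ p ∣ s)
      p∤s = ⟂⇒∤ pp (⟂-·ʳ (prime-⟂ pp p∤m₁) (⟂-sym (pow-⟂ prime[2] 2∤p (k ∸ 2))))
        where
        2∤p : ¬ (+ 2 ∣ + p)
        2∤p h = p∤2 (subst (λ t → + t ∣ + 2) (prime∣prime⇒≡ prime[2] pp (∣⇒∣ᵤ h)) ∣-refl)
      S⟂s : S ⟂ s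
      S⟂s = pow-⟂ pp p∤s (suc M)
      m≡ℤ : + m ≡ + m₁ · S
      m≡ℤ = trans (cong +_ m≡) (ℤₚ.pos-* m₁ (p ^ suc M))
      N≡ : stride 2∤m k ≡ S · s
      N≡ = trans (cong (_· pow 2 (k ∸ 2)) m≡ℤ) (regroup (+ m₁) S (pow 2 (k ∸ 2)))
        where
        regroup : ∀ m S t → m · S · t ≡ S · (m · t)
        regroup = solve-∀
      N∣f₀ : stride 2∤m k ∣ f x₀
      N∣f₀ = ∣-trans (subst (stride 2∤m k ∣_) (stride·gap 2∤m k) (∣m⇒∣m*n (gap k) ∣-refl)) (mk∣f x₀ x₀-root)
      S∣f₀ : S ∣ f x₀
      S∣f₀ = ∣-trans (divides (+ m₁) m≡ℤ) m∣f₀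
      s∣f₀ : s ∣ f x₀
      s∣f₀ = ∣-trans (divides S N≡) N∣f₀
      S∣mk : S ∣ + m · pow 2 k
      S∣mk = ∣m⇒∣m*n (pow 2 k) (divides (+ m₁) m≡ℤ)
      lifted : Evenℕ (suc M) × ¬ (+ p · + p ∣ + r) × S ∣ s · z₀ · (s · z₀)
      lifted = odd-prime-lift pp p∤2 {a′ · s · s} {s · z₀} {+ r} {M}
        (λ h → [ (λ h → [ p∤a′ , p∤s ]′ (euclid pp a′ s h)) , p∤s ]′ (euclid pp (a′ · s) s h)) p∣r
        (λ t → line-lift S s t S⟂s (∣-reflexive N≡) S∣f₀ s∣f₀ S∣f₀ S∣mk)
      even = proj₁ lifted
      p²∤r = proj₁ (proj₂ lifted)
      regroup : ∀ s z → s · z · (s · z) ≡ s · (s · (z · z))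
      regroup = solve-∀
      S∣z₀² : S ∣ z₀ · z₀
      S∣z₀² = ⟂-cancel S⟂s (⟂-cancel S⟂s (subst (S ∣_) (regroup s z₀) (proj₂ (proj₂ lifted))))
      isolate : ∀ z e t → z ≡ t + e → z - t ≡ e
      isolate z e t refl = cancel t e
        where
        cancel : ∀ t e → t + e - t ≡ e
        cancel = solve-∀

    even-prime-power : ∃[ M ] EvenPrimePower m (p , M) × pow p M ∣ ε × ¬ (+ p · + p ∣ + r)
    even-prime-power = conclude (factor-power pp m {{ℕ.≢-nonZero λ { refl → 2∤m (divides (+ 0) refl) }}} (∣⇒∣ᵤ p∣m))
      where
      conclude : ∃₂ (λ M m₁ → 1 ≤ M × m ≡ m₁ * p ^ M × ¬ (+ p ∣ + m₁)) →
        ∃[ M ] EvenPrimePower m (p , M) × pow p M ∣ ε × ¬ (+ p · + p ∣ + r)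
      conclude (suc M , m₁ , _ , m≡ , p∤m₁) = let even , p²∤r , S∣ε = odd-prime-power M m₁ m≡ p∤m₁ in
        suc M , (pp , odd , cofactor⇒multiplicity pp p∤m₁ (trans (cong +_ m≡) (ℤₚ.pos-* m₁ (p ^ suc M))) , even) , S∣ε , p²∤r
        where
        odd : Oddℕ p
        odd 2∣p = 2∤m (∣-trans (∣ᵤ⇒∣ 2∣p) p∣m)

  -- A prime repeated in the factorisation of δ would give p² ∣ δ ∣ r, which `even-prime-power`
  -- excludes. The primes are thus distinct, their powers coprime, and the product of the powers
  -- divides ε because each one does.
  prime-powers : ∀ {δ} → δ ℕ∣.∣ m → δ ℕ∣.∣ r → ∀ ps → All Prime ps → product ps ℕ∣.∣ δ →
    ∃[ pms ] bases pms ≡ ps × All (EvenPrimePower m) pms × + powers pms ∣ ε × Unique (bases pms)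
  prime-powers δ∣m δ∣r [] _ _ = [] , refl , [] , divides ε (sym (ℤₚ.*-identityʳ ε)) , []
  prime-powers {δ} δ∣m δ∣r (p ∷ ps) (pp ∷ pps) ps∣δ = extend
    (prime-powers δ∣m δ∣r ps pps (ℕ∣.∣-trans (ℕ∣.n∣m*n p) ps∣δ))
    (even-prime-power pp (∣ᵤ⇒∣ (ℕ∣.∣-trans p∣δ δ∣m)) (∣ᵤ⇒∣ (ℕ∣.∣-trans p∣δ δ∣r)))
    where
    p∣δ : p ℕ∣.∣ δ
    p∣δ = ℕ∣.∣-trans (ℕ∣.m∣m*n (product ps)) ps∣δ
    extend : (∃[ pms ] bases pms ≡ ps × All (EvenPrimePower m) pms × + powers pms ∣ ε × Unique (bases pms)) →
      (∃[ M ] EvenPrimePower m (p , M) × pow p M ∣ ε × ¬ (+ p · + p ∣ + r)) →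
      ∃[ pms ] bases pms ≡ p ∷ ps × All (EvenPrimePower m) pms × + powers pms ∣ ε × Unique (bases pms)
    extend (pms , refl , goods , powers∣ε , uniq) (M , good , M∣ε , p²∤r) =
      (p , M) ∷ pms , refl , good ∷ goods ,
      subst (_∣ ε) (sym (ℤₚ.pos-* (p ^ M) (powers pms))) (⟂-∣-· (pow-⟂ pp p∤powers M) M∣ε powers∣ε) ,
      All.tabulate (λ {q} q∈ p≡q → p∉ (subst (_∈ bases pms) (sym p≡q) q∈)) ∷ uniq
      where
      p∉ : ¬ (p ∈ bases pms)
      p∉ p∈ = p²∤r (subst (_∣ + r) (ℤₚ.pos-* p p) (∣ᵤ⇒∣ (ℕ∣.∣-trans (ℕ∣.*-monoʳ-∣ p (∈⇒∣product p∈)) (ℕ∣.∣-trans ps∣δ δ∣r))))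
      p∤powers : ¬ (+ p ∣ + powers pms)
      p∤powers h = p∉ (prime∣powers pms pp goods (∣⇒∣ᵤ h))

  δ-condition : ∀ {δ} → δ ≡ gcd m r → δ-Condition m δ ε
  δ-condition {δ} δ≡ = conclude (factorise δ {{ℕ.≢-nonZero δ≢0}})
    where
    δ≢0 : δ ≢ 0
    δ≢0 δ≡0 = 2∤m (subst (λ t → + 2 ∣ + t) (sym (gcd[m,n]≡0⇒m≡0 (trans (sym δ≡) δ≡0))) (divides (+ 0) refl))
    open PrimeFactorisation
    conclude : PrimeFactorisation δ → δ-Condition m δ ε
    conclude fac =
      let pms , bases≡ , goods , powers∣ε , uniq =
            prime-powers (subst (ℕ∣._∣ m) (sym δ≡) (gcd[m,n]∣m m r)) (subst (ℕ∣._∣ r) (sym δ≡) (gcd[m,n]∣n m r))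
              (factors fac) (factorsPrime fac) (ℕ∣.∣-reflexive (sym (isFactorisation fac)))
      in inj₂ (pms , uniq , All.map (λ good → good) goods ,
           trans (isFactorisation fac) (cong product (sym bases≡)) , powers∣ε)

  condition : ∀ {δ} → δ ≡ gcd m r → ∃[ i ] Condition a b c r k m δ i
  condition {δ} δ≡ = by-k k refl
    where
    r∣b : + r ∣ b
    r∣b = divides b′ refl
    r∣c : + r ∣ c
    r∣c = divides c′ refl
    by-k : ∀ k₀ → k ≡ k₀ → ∃[ i ] Condition a b c r k m δ i
    by-k 0 k≡0 = suc zero , k≡0 , r∣b , r∣c , ε , d≡ , residue , δ-condition δ≡
    by-k 1 k≡1 = suc (suc zero) , k≡1 , a′ , b′ , c′ , ε , a≡ , refl , refl , d≡ , k≡1⇒2∤b′ k≡1 , inj₂ (k≡1⇒2∣c′ k≡1) ,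
      residue , δ-condition δ≡
    by-k 2 k≡2 = contradiction k≡2 k≡2⇒⊥
    by-k (suc (suc (suc k₀))) k≡ = suc (suc (suc zero)) , 3≤k , 2∤⇒Odd (Dyadic.2∤r 3≤k) , Dyadic.k-odd 3≤k , r∣b , r∣c ,
      ε , Dyadic.f₀ 3≤k , d≡ , Dyadic.ε-mult 3≤k , d≡f₀ , Dyadic.f₀≈1 3≤k , residue , δ-condition δ≡
      where
      3≤k : 3 ≤ k
      3≤k = subst (3 ≤_) (sym k≡) (s≤s (s≤s (s≤s z≤n)))
      regroup : ∀ f t s → f · t · s ≡ f · (s · t)
      regroup = solve-∀
      d≡f₀ : d ≡ Dyadic.f₀ 3≤k · + (r ^ 2 * 2 ^ (k ∸ 1))
      d≡f₀ = trans d≡ (trans (cong (_· + (r ^ 2)) (Dyadic.ε≡ 3≤k))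
        (trans (regroup (Dyadic.f₀ 3≤k) (pow 2 (k ∸ 1)) (+ (r ^ 2)))
          (cong (Dyadic.f₀ 3≤k ·_) (sym (ℤₚ.pos-* (r ^ 2) (2 ^ (k ∸ 1)))))))

-- Exclusivity of the conditions and assembly of the equivalence

module _ {a n r k m δ} (R : Reduction a n r k m) (δ≡ : δ ≡ gcd m r) where

  root⇒condition : ∀ b c x → Setting.Root R b c x → (∀ x → Setting.Root R b c x → + n ∣ Setting.F R b c x) →
    ∃[ i ] Condition a b c r k m δ i
  root⇒condition b c x x-root H = reduce (valid⇒r∣b R b c x x-root H) (valid⇒r∣c R b c x x-root H) x-root H
    where
    reduce : ∀ {b c} → + r ∣ b → + r ∣ c → Setting.Root R b c x → (∀ x → Setting.Root R b c x → + n ∣ Setting.F R b c x) →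
      ∃[ i ] Condition a b c r k m δ i
    reduce (divides b′ refl) (divides c′ refl) x-root H = Necessity.condition R b′ c′ x x-root H δ≡

  condition-suc⇒ : ∀ {b c} i → Condition a b c r k m δ (suc i) →
    (∃[ x ] Setting.Root R b c x) × (∀ x → Setting.Root R b c x → + n ∣ Setting.F R b c x)
  condition-suc⇒ zero cond@(_ , divides b′ refl , divides c′ refl , _) =
    Reduced.condition-ii⇒ R b′ c′ δ≡ cond
  condition-suc⇒ (suc zero) cond@(_ , _ , b′ , c′ , _ , _ , refl , refl , _) =
    Reduced.condition-iii⇒ R b′ c′ δ≡ cond
  condition-suc⇒ (suc (suc zero)) cond@(_ , _ , _ , divides b′ refl , divides c′ refl , _) =
    Reduced.condition-iv⇒ R b′ c′ δ≡ cond

  -- Condition (i) rules out every root, whereas each of (ii)-(iv) produces one; and (ii)-(iv)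
  -- require different values of k.
  conditions-exclusive : ∀ {b c} i j → Condition a b c r k m δ i → Condition a b c r k m δ j → i ≡ j
  conditions-exclusive zero zero _ _ = refl
  conditions-exclusive {b} {c} zero (suc j) p q =
    let (x , h) , _ = condition-suc⇒ j q in contradiction h (Setting.condition-i⇒¬root R b c p x)
  conditions-exclusive {b} {c} (suc i) zero p q =
    let (x , h) , _ = condition-suc⇒ i p in contradiction h (Setting.condition-i⇒¬root R b c q x)
  conditions-exclusive (suc zero) (suc zero) _ _ = refl
  conditions-exclusive (suc zero) (suc (suc zero)) (refl , _) (() , _)
  conditions-exclusive (suc zero) (suc (suc (suc zero))) (refl , _) (() , _)
  conditions-exclusive (suc (suc zero)) (suc zero) (refl , _) (() , _)
  conditions-exclusive (suc (suc zero)) (suc (suc zero)) _ _ = refl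
  conditions-exclusive (suc (suc zero)) (suc (suc (suc zero))) (refl , _) (s≤s () , _)
  conditions-exclusive (suc (suc (suc zero))) (suc zero) (() , _) (refl , _)
  conditions-exclusive (suc (suc (suc zero))) (suc (suc zero)) (s≤s () , _) (refl , _)
  conditions-exclusive (suc (suc (suc zero))) (suc (suc (suc zero))) _ _ = refl

  valid⇒condition : ∀ b c → QuadraticResidue (discriminant a b c) n → IQFValid a b c n →
    ∃[ i ] Condition a b c r k m δ i
  valid⇒condition b c residue valid =
    [ (λ (x , h) → root⇒condition b c x h (Setting.valid⇒ R b c valid)) , (λ cond → zero , cond) ]′
      (root-or-condition-i R b c residue)

  condition⇒valid : ∀ b c i → Condition a b c r k m δ i → IQFValid a b c n
  condition⇒valid b c zero cond = Setting.⇒valid R b c λ x h → contradiction h (Setting.condition-i⇒¬root R b c cond x)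
  condition⇒valid b c (suc i) cond = Setting.⇒valid R b c (proj₂ (condition-suc⇒ i cond))

-- Decidability is what allows validity to choose between (a) and (b) constructively.
residue? : ∀ u v .{{_ : NonZero v}} → Dec (QuadraticResidue u v)
residue? u v = map′ (λ (x , h) → x , subst (+ v ∣_) (identity u x) h) (λ (x , h) → x , subst (+ v ∣_) (sym (identity u x)) h)
  (quad-root? (+ 1) (+ 0) (- u) v)
  where
  identity : ∀ u x → + 1 · x · x + + 0 · x + - u ≡ x · x - u
  identity = solve-∀

reduction : ∀ {a n r n/r k m} → 2 ≤ n → ¬ (+ n ∣ a) → r ≡ gcd ∣ a ∣ n → n ≡ n/r * r →
  IsMultiplicity 2 k (+ n/r) → n ≡ m * (2 ^ k * r) → Reduction a n r k m
reduction {a} {n} {r} {n/r} {k} {m} 2≤n n∤a r≡ n≡ (_ , k-max) n≡m = record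
  { a′ = a′
  ; a≡ = _∣_.equality gcd∣a
  ; n≡ = trans (cong +_ n≡) (trans (ℤₚ.pos-* n/r r) (cong (_· + r) n/r≡ℤ))
  ; a′⟂ = subst (a′ ⟂_) n/r≡ℤ (coprime⇒⟂ a′ (+ n/r) coprime)
  ; 2∤m = λ 2∣m → ℕₚ.n≮n k (k-max (suc k) (subst₂ _∣_ (sym (pow-suc 2 k)) (sym n/r≡ℤ) (*-monoˡ-∣ (pow 2 k) 2∣m)))
  ; r≢0 = r-nonZero
  ; a≢0 = λ { refl → n∤a (divides (+ 0) refl) }
  }
  where
  r≢0 : r ≢ 0
  r≢0 refl = contradiction (subst (2 ≤_) (trans n≡ (ℕₚ.*-zeroʳ n/r)) 2≤n) λ ()
  instance
    r-nonZero : NonZero r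
    r-nonZero = ℕ.≢-nonZero r≢0
  gcd∣a : + r ∣ a
  gcd∣a = ∣ᵤ⇒∣ (subst (ℕ∣._∣ ∣ a ∣) (sym r≡) (gcd[m,n]∣m ∣ a ∣ n))
  a′ = _∣_.quotient gcd∣a
  n/r≡ : n/r ≡ m * 2 ^ k
  n/r≡ = ℕₚ.*-cancelʳ-≡ n/r (m * 2 ^ k) r (trans (sym n≡) (trans n≡m (sym (ℕₚ.*-assoc m (2 ^ k) r))))
  n/r≡ℤ : + n/r ≡ + m · pow 2 k
  n/r≡ℤ = trans (cong +_ n/r≡) (ℤₚ.pos-* m (2 ^ k))
  coprime : ∀ {i} → (i ℕ∣.∣ ∣ a′ ∣) × (i ℕ∣.∣ n/r) → i ≡ 1
  coprime {i} (i∣a′ , i∣n/r) = ℕ∣.∣1⇒≡1 (ℕ∣.*-cancelʳ-∣ r (subst (i * r ℕ∣.∣_) (trans (sym r≡) (sym (ℕₚ.*-identityˡ r)))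
    (gcd-greatest
      (subst (i * r ℕ∣.∣_) (trans (sym (ℤₚ.abs-* a′ (+ r))) (cong ∣_∣ (sym (_∣_.equality gcd∣a)))) (ℕ∣.*-monoˡ-∣ r i∣a′))
      (subst (i * r ℕ∣.∣_) (sym n≡) (ℕ∣.*-monoˡ-∣ r i∣n/r)))))

theorem6p1 : (a b c : ℤ) (n : ℕ) → 2 ≤ n → ¬ (+ n ∣ a) →
    (r n/r k m δ : ℕ) →
    r ≡ gcd ∣ a ∣ n →
    n ≡ n/r * r →
    IsMultiplicity 2 k (+ n/r) →
    n ≡ m * (2 ^ k * r) →
    δ ≡ gcd m r →
    (IQFValid a b c n
    ⇔
    ( ¬ QuadraticResidue (discriminant a b c) n
    ⊎ ( QuadraticResidue (discriminant a b c) n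
    × ∃! _≡_ (Condition a b c r k m δ))))
    × (∀ (i j : Fin 4) → Condition a b c r k m δ i → Condition a b c r k m δ j → i ≡ j)
theorem6p1 a b c n 2≤n n∤a r n/r k m δ r≡ n≡ k-mult n≡m δ≡ = mk⇔ forwards backwards , conditions-exclusive R δ≡
  where
  R : Reduction a n r k m
  R = reduction 2≤n n∤a r≡ n≡ k-mult n≡m
  D = discriminant a b c
  forwards : IQFValid a b c n → ¬ QuadraticResidue D n ⊎ (QuadraticResidue D n × ∃! _≡_ (Condition a b c r k m δ))
  forwards valid with residue? D n {{ℕ.>-nonZero (ℕₚ.<-trans (s≤s z≤n) 2≤n)}}
  ... | no ¬residue = inj₁ ¬residue
  ... | yes residue = let i , cond = valid⇒condition R δ≡ b c residue valid in
    inj₂ (residue , i , cond , λ {j} → conditions-exclusive R δ≡ i j cond)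
  backwards : ¬ QuadraticResidue D n ⊎ (QuadraticResidue D n × ∃! _≡_ (Condition a b c r k m δ)) → IQFValid a b c n
  backwards (inj₁ ¬residue) = Setting.⇒valid R b c λ x h → contradiction (Setting.root⇒residue R b c x h) ¬residue
  backwards (inj₂ (_ , i , cond , _)) = condition⇒valid R δ≡ b c i cond
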